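{- There is an algorithm that, given a one-dimensional robot game $(U,V)$ (with all integers encoded in binary), computes a description of its set of winning counter values, and runs in time exponential in the input size $\sum_{w\in U\cup V}\log(|w|)$. The description it returns is either $\{0\}$, or a set $d\mathbb{Z}$, or the union of a set of the form $\{x\in d\mathbb{Z}\mid x>b\}$ or $\{x\in d\mathbb{Z}\mid x<b\}$ with an explicitly computed finite set of integers.
   Context: A robot game in dimension one is a pair $(U,V)$ of finite nonempty subsets of $\mathbb{Z}$; $U$ belongs to the reacher and $V$ to the opponent. From an initial counter value $x_0\in\mathbb{Z}$, a play proceeds in rounds: in a round starting at counter value $x$, the opponent chooses $v\in V$ and the counter becomes $x+v$, then the reacher chooses $u\in U$ and the counter becomes $x+v+u$, where the round ends. The reacher wins the play if some round ends at $0$; by convention the reacher wins immediately if the play starts at $0$. Strategies are functions from play prefixes to moves. A counter value $x$ is winning if the reacher has a strategy such that, against every opponent strategy, the play from $x$ is won by the reacher. -}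

module Defs where

open import Data.Nat as ℕ using (ℕ; suc; NonZero)
open import Data.Nat.Binary using (ℕᵇ; zero; 2[1+_]; 1+[2_]; fromℕ)
open import Data.Nat.Logarithm using (⌈log₂_⌉)
open import Data.Integer as ℤ using (ℤ; +_; -[1+_]; ∣_∣; 0ℤ)
open import Data.Integer.Divisibility using (_∣_)
open import Data.Fin using (Fin)
open import Data.Vec using (Vec; []; _∷_)
import Data.Vec as Vec
open import Data.List using (List; []; _∷_; _++_; map; deduplicate; length)
import Data.List as List
open import Data.Nat.ListAction using (sum)
open import Data.List.Membership.Propositional using (_∈_)
open import Data.List.Relation.Unary.Unique.Propositional using (Unique)
open import Data.Product using (_×_; _,_; ∃-syntax; Σ-syntax)
open import Data.Sum using (_⊎_)
open import Relation.Binary.PropositionalEquality using (_≡_; _≢_)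

-- One-dimensional robot games.  A finite set of integers is given by a
-- repetition-free enumeration.

record RobotGame : Set where
  field
    U V        : List ℤ          -- U: reacher, V: opponent
    U-nonempty : U ≢ []
    V-nonempty : V ≢ []
    U-unique   : Unique U
    V-unique   : Unique V

module _ (G : RobotGame) where
  open RobotGame G

  Move : List ℤ → Set
  Move W = ∃[ w ] w ∈ W

  Round : Set
  Round = Move V × Move U

  -- A prefix ending between two rounds: the initial counter value and the
  -- rounds played so far, most recent first.
  Prefix : Set
  Prefix = ℤ × List Round

  counter : Prefix → ℤ
  counter (x , [])                        = x
  counter (x , ((v , _) , (u , _)) ∷ rs)  = counter (x , rs) ℤ.+ v ℤ.+ u

  OpponentStrategy : Set
  OpponentStrategy = Prefix → Move V

  -- The additional argument is the opponent's move in the current round.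
  ReacherStrategy : Set
  ReacherStrategy = Prefix → Move V → Move U

  rounds : ReacherStrategy → OpponentStrategy → ℤ → ℕ → List Round
  rounds σ τ x ℕ.zero  = []
  rounds σ τ x (suc n) = (v , σ p v) ∷ rounds σ τ x n
    where
    p : Prefix
    p = x , rounds σ τ x n
    v : Move V
    v = τ p

  -- n = 0 is the convention that a play starting at 0 is won immediately.
  WinsPlay : ReacherStrategy → OpponentStrategy → ℤ → Set
  WinsPlay σ τ x = ∃[ n ] counter (x , rounds σ τ x n) ≡ 0ℤ

  Winning : ℤ → Set
  Winning x = Σ[ σ ∈ ReacherStrategy ] ∀ (τ : OpponentStrategy) → WinsPlay σ τ x

-- The logarithms are rounded up, and log 0 is read as 0.
size : RobotGame → ℕ
size G = sum (map (λ w → ⌈log₂ ∣ w ∣ ⌉) (deduplicate ℤ._≟_ (U ++ V)))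
  where open RobotGame G

data Description : Set where
  only-zero : Description
  multiples : (d : ℕ) .{{_ : NonZero d}} → Description
  above     : (d : ℕ) .{{_ : NonZero d}} (b : ℤ) (F : List ℤ) → Description
  below     : (d : ℕ) .{{_ : NonZero d}} (b : ℤ) (F : List ℤ) → Description

⟦_⟧ : Description → ℤ → Set
⟦ only-zero   ⟧ x = x ≡ 0ℤ
⟦ multiples d ⟧ x = + d ∣ x
⟦ above d b F ⟧ x = (+ d ∣ x × b ℤ.< x) ⊎ x ∈ F
⟦ below d b F ⟧ x = (+ d ∣ x × x ℤ.< b) ⊎ x ∈ F

-- Model of computation: pure first-order Lisp on binary trees, call by value.
-- A program is a finite table of mutually recursive functions together with
-- a main expression in one variable, the input.  Evaluating any node of the
-- syntax costs one unit.  Since trees can only be built by single cons cells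
-- and inspected one cell at a time, running time in this model agrees with
-- Turing machine time up to a polynomial (results may be kept as shared
-- graphs), so the exponential time bounds are the same.

infixr 5 _·_

data Tree : Set where
  nil : Tree
  _·_ : Tree → Tree → Tree

-- The arities of the functions in the table.
Signature : Set
Signature = List ℕ

data Expr (S : Signature) (n : ℕ) : Set where
  var  : Fin n → Expr S n
  nil  : Expr S n
  cons : Expr S n → Expr S n → Expr S n
  -- the second branch binds the head (variable 0) and the tail (variable 1)
  case : Expr S n → Expr S n → Expr S (suc (suc n)) → Expr S n
  bind : Expr S n → Expr S (suc n) → Expr S n
  call : (f : Fin (length S)) → Vec (Expr S n) (List.lookup S f) → Expr S n

record Program : Set where
  field
    sig  : Signature
    body : (f : Fin (length sig)) → Expr sig (List.lookup sig f)
    main : Expr sig 1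

module _ (P : Program) where
  open Program P

  infix 4 _⊢_⇓_[_] _⊢*_⇓_[_]

  -- ρ ⊢ e ⇓ v [ t ]: in environment ρ, e evaluates to v in time t.
  mutual
    data _⊢_⇓_[_] {n} (ρ : Vec Tree n) : Expr sig n → Tree → ℕ → Set where
      var  : ∀ i → ρ ⊢ var i ⇓ Vec.lookup ρ i [ 1 ]
      nil  : ρ ⊢ nil ⇓ nil [ 1 ]
      cons : ∀ {e₁ e₂ v₁ v₂ t₁ t₂} →
             ρ ⊢ e₁ ⇓ v₁ [ t₁ ] → ρ ⊢ e₂ ⇓ v₂ [ t₂ ] →
             ρ ⊢ cons e₁ e₂ ⇓ v₁ · v₂ [ suc (t₁ ℕ.+ t₂) ]
      case-nil  : ∀ {e e₁ e₂ w t₁ t₂} →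
                  ρ ⊢ e ⇓ nil [ t₁ ] → ρ ⊢ e₁ ⇓ w [ t₂ ] →
                  ρ ⊢ case e e₁ e₂ ⇓ w [ suc (t₁ ℕ.+ t₂) ]
      case-cons : ∀ {e e₁ e₂ v₁ v₂ w t₁ t₂} →
                  ρ ⊢ e ⇓ v₁ · v₂ [ t₁ ] → v₁ ∷ v₂ ∷ ρ ⊢ e₂ ⇓ w [ t₂ ] →
                  ρ ⊢ case e e₁ e₂ ⇓ w [ suc (t₁ ℕ.+ t₂) ]
      bind : ∀ {e₁ e₂ v w t₁ t₂} →
             ρ ⊢ e₁ ⇓ v [ t₁ ] → v ∷ ρ ⊢ e₂ ⇓ w [ t₂ ] →
             ρ ⊢ bind e₁ e₂ ⇓ w [ suc (t₁ ℕ.+ t₂) ]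
      call : ∀ f {es vs w t₁ t₂} →
             ρ ⊢* es ⇓ vs [ t₁ ] → vs ⊢ body f ⇓ w [ t₂ ] →
             ρ ⊢ call f es ⇓ w [ suc (t₁ ℕ.+ t₂) ]

    data _⊢*_⇓_[_] {n} (ρ : Vec Tree n) :
         ∀ {m} → Vec (Expr sig n) m → Vec Tree m → ℕ → Set where
      []  : ρ ⊢* [] ⇓ [] [ 0 ]
      _∷_ : ∀ {m e v t₁ t₂} {es : Vec (Expr sig n) m} {vs} →
            ρ ⊢ e ⇓ v [ t₁ ] → ρ ⊢* es ⇓ vs [ t₂ ] →
            ρ ⊢* e ∷ es ⇓ v ∷ vs [ t₁ ℕ.+ t₂ ]

  OnInput_Returns_InTime_ : Tree → Tree → ℕ → Set
  OnInput i Returns o InTime t = i ∷ [] ⊢ main ⇓ o [ t ]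

-- Encodings.  Natural numbers are lists of binary digits, least significant
-- first.  The digits are those of ℕᵇ (values 1 and 2), so the number n has
-- ⌊log₂ (1 + n)⌋ of them and every number has a unique encoding.

one : Tree
one = nil · nil

encodeℕᵇ : ℕᵇ → Tree
encodeℕᵇ zero      = nil
encodeℕᵇ 1+[2 n ]  = nil · encodeℕᵇ n
encodeℕᵇ 2[1+ n ]  = one · encodeℕᵇ n

encodeℕ : ℕ → Tree
encodeℕ n = encodeℕᵇ (fromℕ n)

encodeℤ : ℤ → Tree
encodeℤ (+ n)    = nil · encodeℕ n
encodeℤ -[1+ n ] = one · encodeℕ (suc n)

encodeList : List ℤ → Tree
encodeList []       = nil
encodeList (x ∷ xs) = encodeℤ x · encodeList xs

encodeGame : RobotGame → Tree
encodeGame G = encodeList U · encodeList V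
  where open RobotGame G

encodeDescription : Description → Tree
encodeDescription only-zero     = encodeℕ 0 · nil
encodeDescription (multiples d) = encodeℕ 1 · encodeℕ d
encodeDescription (above d b F) = encodeℕ 2 · encodeℕ d · encodeℤ b · encodeList F
encodeDescription (below d b F) = encodeℕ 3 · encodeℕ d · encodeℤ b · encodeList F

{-# OPTIONS --safe #-}
module Submission where

-- A value c is won in one round if every v is answered by some u with
-- c + v + u = 0.  If 0 is the only such value, nothing else is winning.
-- Otherwise take c > 0, say (the other case is a mirror image).  The winning set
-- W is closed under addition, so it contains c, 2c, 3c, …, and W mod c is
-- a group, generated by some d ∣ c.
--
-- Let S be the least fixed point of the winning rule inside a window [-B , B]
-- with B cubic in the sum of the moves.  The sets of residues mod c that S meets
-- in layers of height L grow with the layer and so are stationary between two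
-- consecutive ones of the first c + 2 layers; a move played from the second of them shows that the
-- first meets all residues of W.  Hence S and W agree on a long interval, d is
-- the least distance between elements of S, and W is dℤ if S has elements of
-- both signs, and S ∪ { x ∈ dℤ ∣ x > B } if S is nonnegative.
--
-- S is computed as a bitmap with unary arithmetic.  This is polynomial in the
-- absolute values of the moves, hence exponential in the size of the input.

open import Defs
open import Data.Bool as Bool using (Bool; true; false; _∨_; _∧_; if_then_else_)
open import Data.Bool.ListAction using (any; all)
import Data.Bool.Properties as Boolₚ
open import Data.Empty using (⊥; ⊥-elim)
open import Data.Fin as Fin using (Fin; zero; suc; #_; toℕ; fromℕ<; punchIn; punchOut)
import Data.Fin.Properties as Finₚ
open import Data.Integer as ℤ using (ℤ; +_; -[1+_]; ∣_∣; 0ℤ; 1ℤ; +≤+; -≤+)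
open import Data.Integer.Divisibility using (_∣_)
import Data.Integer.Divisibility.Signed as Signed
open import Data.Integer.DivMod using (_/ℕ_; _%ℕ_; a≡a%ℕn+[a/ℕn]*n; n%ℕd<d)
import Data.Integer.Properties as ℤₚ
import Data.Integer.Tactic.RingSolver as ℤSolver
open import Data.List as List using (List; []; _∷_; _++_; _ʳ++_; map; length; drop; replicate)
open import Data.List.Membership.DecPropositional ℤ._≟_ using (_∈?_)
open import Data.List.Membership.Propositional using (_∈_)
open import Data.List.Membership.Propositional.Properties using (∈-lookup; ∈-map⁺; ∈-map⁻; ∈-deduplicate⁺; ∈-++⁺ˡ; ∈-++⁺ʳ)
open import Data.List.Properties as Listₚ using (length-replicate)
import Data.List.Relation.Unary.All as All
open import Data.List.Relation.Unary.AllPairs using (_∷_)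
open import Data.List.Relation.Unary.Any as Any using (here; there)
import Data.List.Relation.Unary.Any.Properties as Anyₚ
open import Data.List.Relation.Unary.Unique.Propositional using (Unique)
open import Data.Nat as ℕ using (ℕ; zero; suc; z≤n; s≤s; NonZero)
open import Data.Nat.Binary as ℕᵇ using (ℕᵇ; 2[1+_]; 1+[2_]; fromℕ)
import Data.Nat.Binary.Properties as ℕᵇₚ
import Data.Nat.Divisibility as ℕ∣
open import Data.Nat.Induction using (<-rec)
open import Data.Nat.ListAction using (sum)
open import Data.Nat.Logarithm using (⌈log₂_⌉; ⌈log₂⌉-mono-≤; ⌈log₂⌈n/2⌉⌉≡⌈log₂n⌉∸1)
import Data.Nat.Properties as ℕₚ
import Data.Nat.Tactic.RingSolver as ℕSolver
open import Data.Product using (_×_; _,_; proj₁; proj₂; map₂; ∃-syntax; Σ-syntax)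
open import Data.Sum as Sum using (_⊎_; inj₁; inj₂)
open import Data.Vec as Vec using (Vec; []; _∷_)
open import Function.Base using (_∘_; _$_)
open import Function.Bundles using (_⇔_; mk⇔; Equivalence)
open import Relation.Binary.PropositionalEquality
open import Relation.Nullary using (¬_; Dec; yes; no)
open import Relation.Nullary.Decidable as Dec using (True; toWitness; decidable-stable)

-- The games over ℤ

-- The obstacle is that a winning play may leave any fixed window, so winning inside the window
-- could be less than winning. What survives is the residue modulo `c`: since `c` is won in one
-- round, `S` is closed under adding `c` as long as the window lasts, and any member stands for all
-- higher values of its residue.
--
-- The layer height `L = (1 + p) c` is a multiple of `c`, so a shift by `L` keeps residues, and it
-- is at least `p + c`, so a round begun at height `L` above a layer ends above the members of that
-- layer. There are `c` residues, so at most `c` of the `c + 1` steps between the first `c + 2`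
-- layers can add one. As `c ≤ p`, these layers stay below about `(1 + p) (1 + p) p`, which is why
-- `B` is cubic.
--
-- `W` mod `c` has inverses because `c - 1` copies of `x` are congruent to `- x`.
--
-- Strategies enter only at the end. A derivation of `Win` yields a strategy of the reacher, but a
-- strategy of the opponent needs a decidable set to stay out of, and decidability of the winning
-- set comes from the description itself.

module IntegerGames where
  open import Data.Integer using (_≤_; _<_; _+_; _*_; -_)

  -- If stage 1 adds some `i` to stage 0, then `i` persists, and the remaining `n` elements are
  -- treated from stage 1 on. Monotonicity is asked for only up to stage `n`, because the layers end
  -- with the window.
  stabilises : ∀ n (P : ℕ → Fin n → Set) → (∀ k i → Dec (P k i)) →
               (∀ k → k ℕ.≤ n → ∀ i → P k i → P (suc k) i) →
               ∃[ k ] k ℕ.≤ n × (∀ i → P (suc k) i → P k i)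
  stabilises zero    P P? mono = 0 , z≤n , λ ()
  stabilises (suc n) P P? mono with Finₚ.any? (λ i → P? 1 i ×-no P? 0 i)
    where
    _×-no_ : ∀ {A B : Set} → Dec A → Dec B → Dec (A × ¬ B)
    yes a ×-no yes b = no λ (_ , ¬b) → ¬b b
    yes a ×-no no ¬b = yes (a , ¬b)
    no ¬a ×-no _     = no (¬a ∘ proj₁)
  ... | no none = 0 , z≤n , λ i p → decidable-stable (P? 0 i) λ ¬p → none (i , p , ¬p)
  ... | yes (i , p , _) with stabilises n (λ k j → P (suc k) (punchIn i j)) (λ k j → P? (suc k) (punchIn i j))
                               (λ k k≤n j → mono (suc k) (s≤s k≤n) (punchIn i j))
  ...   | k , k≤n , stable = suc k , s≤s k≤n , stable′
    where
    persists : ∀ l → l ℕ.≤ n → P (suc l) i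
    persists zero    _   = p
    persists (suc l) l<n = mono (suc l) (ℕₚ.≤-trans l<n (ℕₚ.n≤1+n n)) i (persists l (ℕₚ.<⇒≤ l<n))

    stable′ : ∀ j → P (suc (suc k)) j → P (suc k) j
    stable′ j q with i Fin.≟ j
    ... | yes refl = persists k k≤n
    ... | no i≢j   = subst (P (suc k)) (Finₚ.punchIn-punchOut i≢j)
                       (stable (punchOut i≢j) (subst (P (suc (suc k))) (sym (Finₚ.punchIn-punchOut i≢j)) q))

  -- Linear arithmetic: d - c = b - a.
  lin : ∀ {a b c d} → a ≤ b → d + a ≡ c + b → c ≤ d
  lin {a} {b} {c} {d} a≤b eq = subst₂ _≤_ (cancel c b) (cancel d b)
    (ℤₚ.+-monoˡ-≤ (- b) (ℤₚ.≤-trans (ℤₚ.≤-reflexive (sym eq)) (ℤₚ.+-monoʳ-≤ d a≤b)))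
    where
    cancel : ∀ x y → x + y + - y ≡ x
    cancel = ℤSolver.solve-∀

  infixr 6 _⊕_
  _⊕_ : ∀ {a b c d} → a ≤ b → c ≤ d → a + c ≤ b + d
  _⊕_ = ℤₚ.+-mono-≤

  nonneg-factor : ∀ c k → 0ℤ ≤ k * + suc c → ∃[ n ] k ≡ + n
  -- For negative `k` the product computes to a negative constructor, so coverage refutes that case.
  nonneg-factor c (+ n) _ = n , refl

  module Game {n m : ℕ} (w : Fin n → Fin m → ℤ) where

    -- A derivation is a strategy of the reacher unfolded into a well-founded tree. Only the total
    -- weight `w i j` of a round enters, so a game is mirrored by negating `w`.
    data Win : ℤ → Set where
      won  : Win 0ℤ
      move : ∀ {x} → (∀ i → ∃[ j ] Win (x + w i j)) → Win x

    swap-last : ∀ x y z → x + y + z ≡ x + z + y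
    swap-last = ℤSolver.solve-∀

    -- The strategy from `x` is played with the counter translated by `y`; where it would reach 0 it
    -- reaches `y`, and the strategy from `y` takes over.
    Win-+ : ∀ {x y} → Win x → Win y → Win (x + y)
    Win-+ {y = y} won b = subst Win (sym (ℤₚ.+-identityˡ y)) b
    Win-+ {x} {y} (move f) b = move λ i → proj₁ (f i) ,
      subst Win (swap-last x (w i (proj₁ (f i))) y) (Win-+ (proj₂ (f i)) b)

    Win-* : ∀ k {x} → Win x → Win (+ k * x)
    Win-* zero    {x} a = subst Win (sym (ℤₚ.*-zeroˡ x)) won
    Win-* (suc k) {x} a = subst Win (sym (ℤₚ.suc-* (+ k) x)) (Win-+ a (Win-* k a))

    OneRound : ℤ → Set
    OneRound c = ∀ i → ∃[ j ] c + w i j ≡ 0ℤ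

    OneRound⇒Win : ∀ {c} → OneRound c → Win c
    OneRound⇒Win f = move λ i → proj₁ (f i) , subst Win (sym (proj₂ (f i))) won

    -- Descend the derivation: either all its replies lead to 0, or some move of the opponent leads
    -- to a nonzero value with a smaller derivation.
    Win⇒OneRound : ∀ {x} → Win x → x ≢ 0ℤ → ∃[ c ] c ≢ 0ℤ × OneRound c
    Win⇒OneRound won x≢0 = ⊥-elim (x≢0 refl)
    Win⇒OneRound {x} (move f) x≢0 with Finₚ.all? (λ i → x + w i (proj₁ (f i)) ℤ.≟ 0ℤ)
    ... | yes all = x , x≢0 , λ i → proj₁ (f i) , all i
    ... | no ¬all with Finₚ.¬∀⟶∃¬ _ _ (λ i → x + w i (proj₁ (f i)) ℤ.≟ 0ℤ) ¬all
    ...   | i , ≢0 = Win⇒OneRound (proj₂ (f i)) ≢0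

  -- The interface to the computed bitmap: `sound` stands for leastness, `closed` for being a fixed
  -- point of the rule cut off at `B`. The change of the counter in one round is bounded by `p`.
  record Window {n m : ℕ} (w : Fin n → Fin m → ℤ) (p B : ℕ) (S : ℤ → Set) : Set where
    open Game w
    field
      player   : Fin n
      S?       : ∀ x → Dec (S x)
      sound    : ∀ {x} → S x → Win x
      zero∈S   : S 0ℤ
      closed   : ∀ {x} → - + B ≤ x → x ≤ + B → (∀ i → ∃[ j ] S (x + w i j)) → S x
      S≤       : ∀ {x} → S x → x ≤ + B
      ≤S       : ∀ {x} → S x → - + B ≤ x
      w≤       : ∀ i j → w i j ≤ + p
      ≤w       : ∀ i j → - + p ≤ w i j
      -- Room for the layers k L with k ≤ c and for one more L, where c ≤ p is a
      -- value won in one round and L = (1 + p) c, with a margin of 3 p.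
      B-large  : suc p ℕ.* (suc p ℕ.* p) ℕ.+ (p ℕ.+ p ℕ.+ p) ℕ.≤ B

  record LeastGap (S : ℤ → Set) (d : ℕ) : Set where
    field
      {start} : ℤ
      first   : S start
      second  : S (start + + d)
      least   : ∀ r → 1 ℕ.≤ r → r ℕ.< d → ∀ {x} → S x → S (x + + r) → ⊥

  -- Winning values compared with the members of a window.

  module WindowProperties {n m : ℕ} {w : Fin n → Fin m → ℤ} {p B : ℕ} {S : ℤ → Set} (W : Window w p B S) where
    open Game w
    open Window W

    p≤B : + p ≤ + B
    p≤B = +≤+ (ℕₚ.≤-trans (ℕₚ.m≤n+m p (p ℕ.+ p)) (ℕₚ.≤-trans (ℕₚ.m≤n+m _ (suc p ℕ.* (suc p ℕ.* p))) B-large))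

    0≤B : 0ℤ ≤ + B
    0≤B = +≤+ z≤n

    -B≤0 : - + B ≤ 0ℤ
    -B≤0 = ℤₚ.neg-mono-≤ 0≤B

    OneRound≤ : ∀ {c} → OneRound c → c ≤ + p
    OneRound≤ {c} f = lin (≤w player j ⊕ ℤₚ.≤-reflexive eq) (regroup c (+ p) (w player j))
      where
      j  = proj₁ (f player)
      eq = proj₂ (f player)
      regroup : ∀ c p w → p + (- p + (c + w)) ≡ c + (w + 0ℤ)
      regroup = ℤSolver.solve-∀

    ≤OneRound : ∀ {c} → OneRound c → - + p ≤ c
    ≤OneRound {c} f = lin (w≤ player j ⊕ ℤₚ.≤-reflexive (sym eq)) (regroup c (+ p) (w player j))
      where
      j  = proj₁ (f player)
      eq = proj₂ (f player)
      regroup : ∀ c p w → c + (w + 0ℤ) ≡ - p + (p + (c + w))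
      regroup = ℤSolver.solve-∀

    OneRound⇒S : ∀ {c} → OneRound c → S c
    OneRound⇒S f = closed (ℤₚ.≤-trans (ℤₚ.neg-mono-≤ p≤B) (≤OneRound f)) (ℤₚ.≤-trans (OneRound≤ f) p≤B)
      λ i → proj₁ (f i) , subst S (sym (proj₂ (f i))) zero∈S

    -- A nonzero winning value would yield a nonzero value won in one round, and such values are
    -- small enough to lie in `S`.
    trivial : (∀ {x} → S x → x ≡ 0ℤ) → ∀ {x} → Win x → x ≡ 0ℤ
    trivial S≡0 {x} a with x ℤ.≟ 0ℤ
    ... | yes x≡0 = x≡0
    ... | no x≢0 with Win⇒OneRound a x≢0
    ...   | c , c≢0 , f = ⊥-elim (c≢0 (S≡0 (OneRound⇒S f)))

    module Positive (c′ : ℕ) (reach : OneRound (+ suc c′)) where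

      c p′ L : ℤ
      c  = + suc c′
      p′ = + p
      L  = + suc p * c

      c≤p : c ≤ p′
      c≤p = OneRound≤ reach

      0≤k*L : ∀ k → 0ℤ ≤ + k * L
      0≤k*L k = subst (0ℤ ≤_) (trans (ℤₚ.pos-* k (suc p ℕ.* suc c′)) (cong (λ t → + k * t) (ℤₚ.pos-* (suc p) (suc c′)))) (+≤+ z≤n)

      p+c≤L : p′ + c ≤ L
      p+c≤L = subst (p′ + c ≤_) (ℤₚ.pos-* (suc p) (suc c′))
        (+≤+ (ℕₚ.≤-trans (ℕₚ.≤-reflexive (ℕₚ.+-comm p (suc c′))) (ℕₚ.+-monoʳ-≤ (suc c′) (ℕₚ.m≤m*n p (suc c′)))))

      room : ∀ k → k ℕ.≤ suc c′ → + k * L + L + (p′ + p′ + p′) ≤ + B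
      room k k≤c = ℤₚ.≤-trans (ℤₚ.≤-reflexive (sym eq)) (+≤+ (ℕₚ.≤-trans (ℕₚ.+-monoˡ-≤ (p ℕ.+ p ℕ.+ p) le) B-large))
        where
        c≤p′ : suc c′ ℕ.≤ p
        c≤p′ = ℤₚ.drop‿+≤+ c≤p
        l = suc p ℕ.* suc c′
        le : k ℕ.* l ℕ.+ l ℕ.≤ suc p ℕ.* (suc p ℕ.* p)
        le = ℕₚ.≤-trans (ℕₚ.≤-reflexive (ℕₚ.+-comm (k ℕ.* l) l))
          (ℕₚ.*-mono-≤ (s≤s (ℕₚ.≤-trans k≤c c≤p′)) (ℕₚ.*-monoʳ-≤ (suc p) c≤p′))
        l≡ : + l ≡ L
        l≡ = ℤₚ.pos-* (suc p) (suc c′)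
        eq : + (k ℕ.* l ℕ.+ l ℕ.+ (p ℕ.+ p ℕ.+ p)) ≡ + k * L + L + (p′ + p′ + p′)
        eq = cong (_+ (p′ + p′ + p′)) (cong₂ _+_ (trans (ℤₚ.pos-* k l) (cong (λ t → + k * t) l≡)) l≡)

      0≤k*c : ∀ k → 0ℤ ≤ + k * c
      0≤k*c k = subst (0ℤ ≤_) (ℤₚ.pos-* k (suc c′)) (+≤+ z≤n)

      -- One round played with the replies that win from `c` lowers the counter by exactly `c`.
      up : ∀ k {y} → S y → y + + k * c ≤ + B → S (y + + k * c)
      up zero    {y} s _  = subst S (sym (trans (cong (λ t → y + t) (ℤₚ.*-zeroˡ c)) (ℤₚ.+-identityʳ y))) s
      up (suc k) {y} s le = closed
        (lin (≤S s ⊕ 0≤k*c (suc k)) (b₁ y (+ suc k * c) (+ B))) le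
        λ i → proj₁ (reach i) , subst S (eq i) (up k s (lin (le ⊕ 0≤k*c 1) (b₂ y (+ k) c (+ B))))
        where
        b₁ : ∀ y t B → y + t + (- B + 0ℤ) ≡ - B + (y + t)
        b₁ = ℤSolver.solve-∀
        b₂ : ∀ y k c B → B + (y + (1ℤ + k) * c + 0ℤ) ≡ y + k * c + (B + 1ℤ * c)
        b₂ = ℤSolver.solve-∀
        regroup : ∀ y k c w → y + (1ℤ + k) * c + w ≡ y + k * c + (c + w)
        regroup = ℤSolver.solve-∀
        eq : ∀ i → y + + k * c ≡ y + + suc k * c + w i (proj₁ (reach i))
        eq i = sym (trans (regroup y (+ k) c (w i (proj₁ (reach i))))
          (trans (cong (λ t → y + + k * c + t) (proj₂ (reach i))) (ℤₚ.+-identityʳ _)))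

      upℤ : ∀ k {y z} → S y → z ≡ y + k * c → 0ℤ ≤ k * c → z ≤ + B → S z
      upℤ k s refl 0≤ le with nonneg-factor c′ k 0≤
      ... | n , refl = up n s le

      Layer : ℕ → Fin (suc c′) → Set
      Layer k i = S (+ toℕ i + + k * L)

      toℕ≤p : ∀ (i : Fin (suc c′)) → + toℕ i ≤ p′
      toℕ≤p i = ℤₚ.≤-trans (+≤+ (ℕₚ.<⇒≤ (Finₚ.toℕ<n i))) c≤p

      0≤p′ : 0ℤ ≤ p′
      0≤p′ = +≤+ z≤n

      Layer-mono : ∀ k → k ℕ.≤ suc c′ → ∀ i → Layer k i → Layer (suc k) i
      Layer-mono k k≤c i s = upℤ (+ suc p) s (b₁ (+ toℕ i) (+ k) L)
        (subst (0ℤ ≤_) (ℤₚ.*-identityˡ L) (0≤k*L 1))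
        (lin (room k k≤c ⊕ toℕ≤p i ⊕ 0≤p′ ⊕ 0≤p′) (b₂ (+ toℕ i) (+ k) L p′ (+ B)))
        where
        b₁ : ∀ i k L → i + (1ℤ + k) * L ≡ i + k * L + L
        b₁ = ℤSolver.solve-∀
        b₂ : ∀ i k L p B → B + (k * L + L + (p + p + p) + (i + (0ℤ + 0ℤ))) ≡ i + (1ℤ + k) * L + (B + (p + (p + p)))
        b₂ = ℤSolver.solve-∀

      opaque
        stable-layer : ∃[ k ] k ℕ.≤ suc c′ × (∀ i → Layer (suc k) i → Layer k i)
        stable-layer = stabilises (suc c′) Layer (λ k i → S? _) Layer-mono

      k₀ : ℕ
      k₀ = proj₁ stable-layer

      A : ℤ
      A = + k₀ * L

      A-room : A + L + (p′ + p′ + p′) ≤ + B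
      A-room = room k₀ (proj₁ (proj₂ stable-layer))

      0≤A : 0ℤ ≤ A
      0≤A = 0≤k*L k₀

      stable : ∀ i → S (+ toℕ i + (L + A)) → S (+ toℕ i + A)
      stable i = proj₂ (proj₂ stable-layer) i ∘ subst S (cong (λ t → + toℕ i + t) (sym (ℤₚ.suc-* (+ k₀) L)))

      Represented : ℤ → Set
      Represented z = Σ[ i ∈ Fin (suc c′) ] ∃[ k ] z ≡ + toℕ i + k * c × S (+ toℕ i + A)

      residue : ∀ z → Σ[ i ∈ Fin (suc c′) ] ∃[ k ] z ≡ + toℕ i + k * c
      residue z = fromℕ< (n%ℕd<d z (suc c′)) , z /ℕ suc c′ ,
        trans (a≡a%ℕn+[a/ℕn]*n z (suc c′))
          (cong (λ r → + r + (z /ℕ suc c′) * c) (sym (Finₚ.toℕ-fromℕ< (n%ℕd<d z (suc c′)))))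

      1+toℕ≤c : ∀ (i : Fin (suc c′)) → 1ℤ + + toℕ i ≤ c
      1+toℕ≤c i = +≤+ (Finₚ.toℕ<n i)

      zero-layer : S A
      zero-layer = upℤ (+ k₀ * + suc p) zero∈S (b (+ k₀) (+ suc p) c)
        (subst (0ℤ ≤_) (sym (ℤₚ.*-assoc (+ k₀) (+ suc p) c)) 0≤A)
        (lin (A-room ⊕ 0≤k*L 1 ⊕ 0≤p′ ⊕ 0≤p′ ⊕ 0≤p′) (b₂ A L p′ (+ B)))
        where
        b : ∀ k p c → k * (p * c) ≡ 0ℤ + k * p * c
        b = ℤSolver.solve-∀
        b₂ : ∀ A L p B → B + (A + L + (p + p + p) + (0ℤ + (0ℤ + (0ℤ + 0ℤ)))) ≡ A + (B + (1ℤ * L + (p + (p + p))))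
        b₂ = ℤSolver.solve-∀

      -- The move from z is copied at height L + A above its residue, where the
      -- window contains every state that the inductive hypothesis provides.
      represented : ∀ {z} → Win z → Represented z
      represented won = zero , 0ℤ , refl , subst S (sym (ℤₚ.+-identityˡ A)) zero-layer
      represented {z} (move f) with residue z
      ... | i , q , refl = i , q , refl , stable i (closed
          (ℤₚ.≤-trans -B≤0 (+≤+ z≤n ⊕ subst (0ℤ ≤_) (ℤₚ.*-identityˡ L) (0≤k*L 1) ⊕ 0≤A))
          (lin (A-room ⊕ toℕ≤p i ⊕ 0≤p′ ⊕ 0≤p′) (b₁ (+ toℕ i) L A p′ (+ B)))
          λ l → proj₁ (f l) , at-height l (represented (proj₂ (f l))))
        where
        b₁ : ∀ i L A p B → B + (A + L + (p + p + p) + (i + (0ℤ + 0ℤ))) ≡ i + (L + A) + (B + (p + (p + p)))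
        b₁ = ℤSolver.solve-∀
        -- The target is at least `A + L - p ≥ A + c`, hence above the representative `i′ + A` of
        -- its residue, and steps of `c` lead from there up to it.
        at-height : ∀ l → Represented (z + w l (proj₁ (f l))) → S (+ toℕ i + (L + A) + w l (proj₁ (f l)))
        at-height l (i′ , k′ , eq , s) = upℤ (k′ + - q + + suc p) s
          (trans (b₂ (+ toℕ i) L A x q c) (trans (cong (λ t → t + - q * c + (L + A)) eq) (b₃ (+ toℕ i′) k′ q (+ suc p) c A)))
          (lin (p+c≤L ⊕ ≤w l (proj₁ (f l)) ⊕ 1+toℕ≤c i′ ⊕ +≤+ {0} {toℕ i} z≤n ⊕ -≤1)
            (trans (cong (_+ _) (trans (b₆ (+ toℕ i′) k′ q (+ suc p) c) (cong (λ t → t + - q * c + L + - + toℕ i′) (sym eq)))) (b₄ (+ toℕ i) L x q c p′ (+ toℕ i′))))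
          (lin (A-room ⊕ toℕ≤p i ⊕ w≤ l (proj₁ (f l)) ⊕ 0≤p′) (b₅ (+ toℕ i) L A x p′ (+ B)))
          where
          x = w l (proj₁ (f l))
          -≤1 : 0ℤ ≤ 1ℤ
          -≤1 = +≤+ z≤n
          b₂ : ∀ i L A x q c → i + (L + A) + x ≡ i + q * c + x + - q * c + (L + A)
          b₂ = ℤSolver.solve-∀
          b₃ : ∀ i′ k′ q p c A → i′ + k′ * c + - q * c + (p * c + A) ≡ i′ + A + (k′ + - q + p) * c
          b₃ = ℤSolver.solve-∀
          b₆ : ∀ i′ k′ q p c → (k′ + - q + p) * c ≡ i′ + k′ * c + - q * c + p * c + - i′
          b₆ = ℤSolver.solve-∀
          b₄ : ∀ i L x q c p i′ → i + q * c + x + - q * c + L + - i′ + (p + c + (- p + (1ℤ + i′ + (0ℤ + 0ℤ)))) ≡ 0ℤ + (L + (x + (c + (i + 1ℤ))))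
          b₄ = ℤSolver.solve-∀
          b₅ : ∀ i L A x p B → B + (A + L + (p + p + p) + (i + (x + 0ℤ))) ≡ i + (L + A) + x + (B + (p + (p + p)))
          b₅ = ℤSolver.solve-∀

      0≤1 : 0ℤ ≤ 1ℤ
      0≤1 = +≤+ z≤n

      -- The representative `i + A` has the residue of `y` and lies below `A + c ≤ y`, so steps of
      -- `c` lead from it to `y`. This is the long interval on which `S` contains everything it can.
      cover : ∀ {z y} k → Win z → y ≡ z + k * c → A + c ≤ y → y ≤ + B → S y
      cover {z} {y} k a y≡ ≤y y≤ with represented a
      ... | i , k′ , refl , s = upℤ (k + k′ + - (+ k₀ * + suc p)) s
          (trans y≡ (b₁ (+ toℕ i) k k′ (+ k₀) (+ suc p) c))
          (lin (≤y ⊕ 1+toℕ≤c i ⊕ 0≤1)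
            (trans (cong (λ t → t + (A + c + (1ℤ + + toℕ i + 0ℤ))) eq) (b₂ (+ toℕ i) y A c)))
          y≤
        where
        b₁ : ∀ i k k′ a P c → i + k′ * c + k * c ≡ i + a * (P * c) + (k + k′ + - (a * P)) * c
        b₁ = ℤSolver.solve-∀
        b₂ : ∀ i y A c → y + - A + - i + (A + c + (1ℤ + i + 0ℤ)) ≡ 0ℤ + (y + (c + 1ℤ))
        b₂ = ℤSolver.solve-∀
        b₃ : ∀ i k k′ a P c → (k + k′ + - (a * P)) * c ≡ i + k′ * c + k * c + - (a * (P * c)) + - i
        b₃ = ℤSolver.solve-∀
        eq : (k + k′ + - (+ k₀ * + suc p)) * c ≡ y + - A + - + toℕ i
        eq = trans (b₃ (+ toℕ i) k k′ (+ k₀) (+ suc p) c) (cong (λ t → t + - A + - + toℕ i) (sym y≡))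

      -- Two points at any distance `r ≤ c` fit into the interval of `cover`.
      A+c≤ : ∀ {r} → r ≤ c → A + c + r ≤ + B
      A+c≤ {r} r≤c = lin (A-room ⊕ subst (0ℤ ≤_) (ℤₚ.*-identityˡ L) (0≤k*L 1) ⊕ c≤p ⊕ c≤p ⊕ r≤c ⊕ 0≤p′)
                  (b A L c p′ (+ B) r)
        where
        b : ∀ A L c p B r → B + (A + L + (p + p + p) + (0ℤ + (c + (c + (r + 0ℤ))))) ≡ A + c + r + (B + (L + (p + (p + (c + p)))))
        b = ℤSolver.solve-∀

      Win-c : Win c
      Win-c = OneRound⇒Win reach

      -- Membership in the group generated by the winning set.
      data Eventually (x : ℤ) : Set where
        eventually : ∀ k → Win (x + k * c) → Eventually x

      eventually-natural : ∀ {x} → Eventually x → ∃[ k ] Win (x + + k * c)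
      eventually-natural (eventually (+ k) a) = k , a
      eventually-natural {x} (eventually -[1+ k ] a) = 0 , subst Win (b x (+ suc k) c) (Win-+ a (Win-* (suc k) Win-c))
        where
        b : ∀ x k c → x + - k * c + k * c ≡ x + 0ℤ * c
        b = ℤSolver.solve-∀

      win⇒eventually : ∀ {x} → Win x → Eventually x
      win⇒eventually {x} a = eventually 0ℤ $ subst Win (b x c) a
        where
        b : ∀ x c → x ≡ x + 0ℤ * c
        b = ℤSolver.solve-∀

      eventually-+ : ∀ {x y} → Eventually x → Eventually y → Eventually (x + y)
      eventually-+ {x} {y} (eventually k a) (eventually l b) = eventually (k + l) $ subst Win (e x y k l c) (Win-+ a b)
        where
        e : ∀ x y k l c → x + k * c + (y + l * c) ≡ x + y + (k + l) * c
        e = ℤSolver.solve-∀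

      -- Modulo `c`, the `c′ = c - 1` copies of `x` amount to `- x`.
      eventually-neg : ∀ {x} → Eventually x → Eventually (- x)
      eventually-neg {x} (eventually k a) = eventually (x + + c′ * k) $ subst Win (e x (+ c′) k) (Win-* c′ a)
        where
        e : ∀ x c′ k → c′ * (x + k * (1ℤ + c′)) ≡ - x + (x + c′ * k) * (1ℤ + c′)
        e = ℤSolver.solve-∀

      eventually-*ℕ : ∀ k {x} → Eventually x → Eventually (+ k * x)
      eventually-*ℕ zero    {x} _ = subst Eventually (sym (ℤₚ.*-zeroˡ x)) (win⇒eventually won)
      eventually-*ℕ (suc k) {x} h = subst Eventually (sym (ℤₚ.suc-* (+ k) x)) (eventually-+ h (eventually-*ℕ k h))

      eventually-* : ∀ k {x} → Eventually x → Eventually (k * x)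
      eventually-* (+ k)    h     = eventually-*ℕ k h
      eventually-* -[1+ k ] {x} h = subst Eventually (ℤₚ.neg-distribˡ-* (+ suc k) x)
        (eventually-neg (eventually-*ℕ (suc k) h))

      -- Values from `A + c` on are caught by `cover`. A smaller one cannot jump over `B` in one
      -- round, so the successors chosen by the derivation lie in `S`; these are nonnegative, so the
      -- value is at least `- p` and `closed` applies.
      low : (∀ {x} → S x → 0ℤ ≤ x) → ∀ {x} → Win x → S x ⊎ + B < x
      low S≥0 won = inj₁ zero∈S
      low S≥0 {x} a@(move f) with + B ℤ.<? x | A + c ℤ.≤? x
      ... | yes B<x | _       = inj₂ B<x
      ... | no  B≮x | yes ≤x  = inj₁ (cover 0ℤ a (e x c) ≤x (ℤₚ.≮⇒≥ B≮x))
        where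
        e : ∀ x c → x ≡ x + 0ℤ * c
        e = ℤSolver.solve-∀
      ... | no  B≮x | no  ≰x  = inj₁ (closed -B≤x (ℤₚ.≮⇒≥ B≮x) λ i → proj₁ (f i) , inside i)
        where
        x≤ : x ≤ A + c
        x≤ = ℤₚ.<⇒≤ (ℤₚ.≰⇒> ≰x)
        inside : ∀ i → S (x + w i (proj₁ (f i)))
        inside i with low S≥0 (proj₂ (f i))
        ... | inj₁ s   = s
        ... | inj₂ B<y = ⊥-elim (ℤₚ.<⇒≱ B<y
              (lin (A-room ⊕ x≤ ⊕ w≤ i (proj₁ (f i)) ⊕ p+c≤L ⊕ 0≤p′ ⊕ 0≤p′ ⊕ 0≤p′) (e A L x (w i (proj₁ (f i))) p′ c (+ B))))
          where
          e : ∀ A L x w p c B → B + (A + L + (p + p + p) + (x + (w + (p + c + (0ℤ + (0ℤ + 0ℤ)))))) ≡ x + w + (B + (A + c + (p + (L + (p + (p + p))))))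
          e = ℤSolver.solve-∀
        -B≤x : - + B ≤ x
        -B≤x = lin (S≥0 (inside player) ⊕ w≤ player (proj₁ (f player)) ⊕ p≤B)
                   (e x (w player (proj₁ (f player))) p′ (+ B))
          where
          e : ∀ x w p B → x + (0ℤ + (w + p)) ≡ - B + (x + w + (p + B))
          e = ℤSolver.solve-∀

      -- For `y = - (1 + e)`, the sum of `c` copies of `y` and `e` copies of `c` is `- c`. So `- c`
      -- wins as well, and multiples of `c` can be subtracted.
      negative⇒Win : ∀ {y} → S y → y < 0ℤ → ∀ {x} → Eventually x → Win x
      negative⇒Win {+ _} _ (ℤ.+<+ ())
      negative⇒Win { -[1+ e ]} s _ {x} h with eventually-natural h
      ... | k , a = subst Win (b x (+ k) c) (Win-+ a (Win-* k -c))
        where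
        b : ∀ x k c → x + k * c + k * - c ≡ x
        b = ℤSolver.solve-∀
        b₂ : ∀ e c → c * - (1ℤ + e) + e * c ≡ - c
        b₂ = ℤSolver.solve-∀
        -c : Win (- c)
        -c = subst Win (b₂ (+ e) c) (Win-+ (Win-* (suc c′) (sound s)) (Win-* e Win-c))

      -- The representative of the residue is in `S`, hence at most `B < x`, and the remaining
      -- distance is a natural multiple of `c`.
      above⇒Win : ∀ {x} → Eventually x → + B < x → Win x
      above⇒Win {x} (eventually k a) B<x with represented a
      ... | i , k′ , eq , s with nonneg-factor c′ (k′ + - k + - (+ k₀ * + suc p))
              (lin (ℤₚ.<⇒≤ B<x ⊕ S≤ s) (trans (cong (λ t → t + (+ B + (+ toℕ i + A))) (κ≡)) (b₃ x (+ toℕ i) A (+ B))))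
        where
        b₁ : ∀ i k k′ a P c → (k′ + - k + - (a * P)) * c ≡ i + k′ * c + - k * c + - (a * (P * c)) + - i
        b₁ = ℤSolver.solve-∀
        b₂ : ∀ x k c A i → x + k * c + - k * c + - A + - i ≡ x + - A + - i
        b₂ = ℤSolver.solve-∀
        b₃ : ∀ x i A B → x + - A + - i + (B + (i + A)) ≡ 0ℤ + (x + B)
        b₃ = ℤSolver.solve-∀
        κ≡ : (k′ + - k + - (+ k₀ * + suc p)) * c ≡ x + - A + - + toℕ i
        κ≡ = trans (b₁ (+ toℕ i) k k′ (+ k₀) (+ suc p) c)
               (trans (cong (λ t → t + - k * c + - A + - + toℕ i) (sym eq)) (b₂ x k c A (+ toℕ i)))
      ...   | n , κ≡n = subst Win x≡ (Win-+ (sound s) (Win-* n Win-c))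
        where
        b₁ : ∀ i k k′ a P c → i + a * (P * c) + (k′ + - k + - (a * P)) * c ≡ i + k′ * c + - k * c
        b₁ = ℤSolver.solve-∀
        b₂ : ∀ x k c → x + k * c + - k * c ≡ x
        b₂ = ℤSolver.solve-∀
        x≡ : + toℕ i + A + + n * c ≡ x
        x≡ = trans (cong (λ t → + toℕ i + A + t * c) (sym κ≡n))
          (trans (b₁ (+ toℕ i) k k′ (+ k₀) (+ suc p) c)
            (trans (cong (λ t → t + - k * c) (sym eq)) (b₂ x k c)))

      module _ {d : ℕ} .{{_ : NonZero d}} (gap : LeastGap S d) where
        open LeastGap gap

        d≤c : d ℕ.≤ suc c′
        d≤c = ℕₚ.≮⇒≥ λ c<d → least (suc c′) (s≤s z≤n) c<d zero∈S
          (subst S (sym (ℤₚ.+-identityˡ c)) (OneRound⇒S reach))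

        eventually-d : Eventually (+ d)
        eventually-d = subst Eventually (b start (+ d))
          (eventually-+ (win⇒eventually (sound second)) (eventually-neg (win⇒eventually (sound first))))
          where
          b : ∀ x d → x + d + - x ≡ d
          b = ℤSolver.solve-∀

        ∣⇒eventually : ∀ {x} → + d ∣ x → Eventually x
        ∣⇒eventually {x} d∣x with Signed.∣ᵤ⇒∣ {+ d} {x} d∣x
        ... | Signed.divides q refl = eventually-* q eventually-d

        -- Lifted into the interval of `cover`, 0 and `r` become `A + c` and `A + c + r`, two
        -- members of `S` at a distance below `d`.
        no-gap : ∀ r → 1 ℕ.≤ r → r ℕ.< d → Eventually (+ r) → ⊥
        no-gap r 1≤r r<d (eventually k a) = least r 1≤r r<d
          (cover (+ k₀ * + suc p + 1ℤ) won (b₁ (+ k₀) (+ suc p) c) ℤₚ.≤-refl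
            (subst (_≤ + B) (ℤₚ.+-identityʳ (A + c)) (A+c≤ (+≤+ z≤n))))
          (cover (+ k₀ * + suc p + 1ℤ + - k) a (b₂ (+ k₀) (+ suc p) c (+ r) k)
            (ℤₚ.≤-trans (ℤₚ.≤-reflexive (sym (ℤₚ.+-identityʳ (A + c)))) (ℤₚ.+-monoʳ-≤ (A + c) (+≤+ z≤n)))
            (A+c≤ (+≤+ (ℕₚ.≤-trans (ℕₚ.<⇒≤ r<d) d≤c))))
          where
          b₁ : ∀ a P c → a * (P * c) + c ≡ 0ℤ + (a * P + 1ℤ) * c
          b₁ = ℤSolver.solve-∀
          b₂ : ∀ a P c r k → a * (P * c) + c + r ≡ r + k * c + (a * P + 1ℤ + - k) * c
          b₂ = ℤSolver.solve-∀

        Win⇒∣ : ∀ {x} → Win x → + d ∣ x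
        Win⇒∣ {x} a with x %ℕ d in r≡ | a≡a%ℕn+[a/ℕn]*n x d
        ... | zero  | x≡ = Signed.∣⇒∣ᵤ (Signed.divides (x /ℕ d) (trans x≡ (ℤₚ.+-identityˡ _)))
        ... | suc r | x≡ = ⊥-elim (no-gap (suc r) (s≤s z≤n) (subst (ℕ._< d) r≡ (n%ℕd<d x d))
                (subst Eventually (trans (cong (λ t → t + - (x /ℕ d) * + d) x≡) (b (+ suc r) (x /ℕ d) (+ d)))
                  (eventually-+ (win⇒eventually a) (eventually-* (- (x /ℕ d)) eventually-d))))
          where
          b : ∀ r q d → r + q * d + - q * d ≡ r
          b = ℤSolver.solve-∀

        Win⇔above : (∀ {x} → S x → 0ℤ ≤ x) → ∀ x → Win x ⇔ ((+ d ∣ x × + B < x) ⊎ S x)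
        Win⇔above S≥0 x = mk⇔ to λ { (inj₁ (d∣x , B<x)) → above⇒Win (∣⇒eventually d∣x) B<x ; (inj₂ s) → sound s }
          where
          to : Win x → (+ d ∣ x × + B < x) ⊎ S x
          to a with low S≥0 a
          ... | inj₁ s   = inj₂ s
          ... | inj₂ B<x = inj₁ (Win⇒∣ a , B<x)

        Win⇔multiple : ∀ {y} → S y → y < 0ℤ → ∀ x → Win x ⇔ + d ∣ x
        Win⇔multiple s y<0 x = mk⇔ Win⇒∣ (negative⇒Win s y<0 ∘ ∣⇒eventually)

  -- Mirror images, and the winning set according to the signs in `S`.

  Win-mirror : ∀ {n m} {w w′ : Fin n → Fin m → ℤ} → (∀ i j → w′ i j ≡ - w i j) →
               ∀ {x} → Game.Win w x → Game.Win w′ (- x)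
  Win-mirror eq Game.won = Game.won
  Win-mirror {w = w} {w′} eq {x} (Game.move f) = Game.move λ i → proj₁ (f i) ,
    subst (Game.Win w′) (trans (ℤₚ.neg-distrib-+ x _) (cong (λ t → - x + t) (sym (eq i (proj₁ (f i))))))
      (Win-mirror eq (proj₂ (f i)))

  module _ {n m : ℕ} {w : Fin n → Fin m → ℤ} {p B : ℕ} {S : ℤ → Set} (W : Window w p B S) where
    open Game w
    open Window W

    private
      w⁻ : Fin n → Fin m → ℤ
      w⁻ i j = - w i j

      S⁻ : ℤ → Set
      S⁻ x = S (- x)

    mirror : Window w⁻ p B S⁻
    mirror = record
      { player  = player
      ; S?      = λ x → S? (- x)
      ; sound   = λ {x} s → subst (Game.Win w⁻) (ℤₚ.neg-involutive x) (Win-mirror (λ _ _ → refl) (sound s))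
      ; zero∈S  = zero∈S
      ; closed  = λ {x} -B≤x x≤B f → closed (ℤₚ.neg-mono-≤ x≤B)
          (subst (- x ≤_) (ℤₚ.neg-involutive (+ B)) (ℤₚ.neg-mono-≤ -B≤x))
          λ i → proj₁ (f i) , subst S (b x (w i (proj₁ (f i)))) (proj₂ (f i))
      ; S≤      = λ {x} s → subst₂ _≤_ (ℤₚ.neg-involutive x) (ℤₚ.neg-involutive (+ B)) (ℤₚ.neg-mono-≤ (≤S s))
      ; ≤S      = λ {x} s → subst (- + B ≤_) (ℤₚ.neg-involutive x) (ℤₚ.neg-mono-≤ (S≤ s))
      ; w≤      = λ i j → subst (- w i j ≤_) (ℤₚ.neg-involutive (+ p)) (ℤₚ.neg-mono-≤ (≤w i j))
      ; ≤w      = λ i j → ℤₚ.neg-mono-≤ (w≤ i j)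
      ; B-large = B-large
      }
      where
      b : ∀ x w → - (x + - w) ≡ - x + w
      b = ℤSolver.solve-∀

    mirror-gap : ∀ {d} → LeastGap S d → LeastGap S⁻ d
    mirror-gap {d} gap = record
      { first  = subst S (sym (ℤₚ.neg-involutive _)) second
      ; second = subst S (b₁ start (+ d)) first
      ; least  = λ r 1≤r r<d {x} s t → least r 1≤r r<d t (subst S (b₂ x (+ r)) s)
      }
      where
      open LeastGap gap
      b₁ : ∀ x d → x ≡ - (- (x + d) + d)
      b₁ = ℤSolver.solve-∀
      b₂ : ∀ x r → - x ≡ - (x + r) + r
      b₂ = ℤSolver.solve-∀

    Win⇔mirror : ∀ x → Win x ⇔ Game.Win w⁻ (- x)
    Win⇔mirror x = mk⇔ (Win-mirror (λ _ _ → refl))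
      λ a → subst Win (ℤₚ.neg-involutive x) (Win-mirror (λ i j → sym (ℤₚ.neg-involutive (w i j))) a)

    private
      module P  = WindowProperties W
      module P⁻ = WindowProperties mirror

      mirror-round : ∀ {c} → OneRound c → Game.OneRound w⁻ (- c)
      mirror-round {c} f i = proj₁ (f i) , trans (sym (ℤₚ.neg-distrib-+ c _)) (cong -_ (proj₂ (f i)))

      mirror-∣ : ∀ {d x} → + d ∣ - x → + d ∣ x
      mirror-∣ {d} {x} = subst (d ℕ∣.∣_) (ℤₚ.∣-i∣≡∣i∣ x)

      unmirror-∣ : ∀ {d x} → + d ∣ x → + d ∣ - x
      unmirror-∣ {d} {x} = subst (d ℕ∣.∣_) (sym (ℤₚ.∣-i∣≡∣i∣ x))

    module _ {d : ℕ} .{{_ : NonZero d}} (gap : LeastGap S d) where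

      right-sided : (∀ {x} → S x → 0ℤ ≤ x) → ∀ {y} → S y → y ≢ 0ℤ → ∀ x → Win x ⇔ ((+ d ∣ x × + B < x) ⊎ S x)
      right-sided S≥0 s y≢0 with Win⇒OneRound (sound s) y≢0
      ... | + zero   , c≢0 , _ = ⊥-elim (c≢0 refl)
      ... | + suc c  , _   , r = P.Positive.Win⇔above c r gap S≥0
      -- A negative value won in one round would itself lie in `S`.
      ... | -[1+ c ] , _   , r with S≥0 (P.OneRound⇒S { -[1+ c ]} r)
      ...   | ()

      left-sided : (∀ {x} → S x → x ≤ 0ℤ) → ∀ {y} → S y → y ≢ 0ℤ → ∀ x → Win x ⇔ ((+ d ∣ x × x < - + B) ⊎ S x)
      left-sided S≤0 s y≢0 with Win⇒OneRound (sound s) y≢0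
      ... | + zero   , c≢0 , _ = ⊥-elim (c≢0 refl)
      ... | + suc c  , _   , r with S≤0 (P.OneRound⇒S { + suc c } r)
      ...   | +≤+ ()
      left-sided S≤0 s y≢0 | -[1+ c ] , _ , r = λ x → mk⇔ (to x) (from x)
        where
        equiv = P⁻.Positive.Win⇔above c (mirror-round { -[1+ c ]} r) (mirror-gap gap)
          (λ {x} s → subst (0ℤ ≤_) (ℤₚ.neg-involutive x) (ℤₚ.neg-mono-≤ (S≤0 s)))
        to : ∀ x → Win x → (+ d ∣ x × x < - + B) ⊎ S x
        to x a with equiv (- x) .Equivalence.to (Win⇔mirror x .Equivalence.to a)
        ... | inj₁ (d∣ , B<) = inj₁ (mirror-∣ {x = x} d∣ , subst (_< - + B) (ℤₚ.neg-involutive x) (ℤₚ.neg-mono-< B<))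
        ... | inj₂ s         = inj₂ (subst S (ℤₚ.neg-involutive x) s)
        from : ∀ x → (+ d ∣ x × x < - + B) ⊎ S x → Win x
        from x (inj₂ s)        = sound s
        from x (inj₁ (d∣ , <B)) = Win⇔mirror x .Equivalence.from (equiv (- x) .Equivalence.from
          (inj₁ (unmirror-∣ {x = x} d∣ , subst (_< - x) (ℤₚ.neg-involutive (+ B)) (ℤₚ.neg-mono-< <B))))

      -- The sign of the value won in one round is not known in advance: a positive one is combined
      -- with `y`, a negative one is mirrored and combined with `z`.
      two-sided : ∀ {y z} → S y → y < 0ℤ → S z → 0ℤ < z → ∀ x → Win x ⇔ + d ∣ x
      two-sided s y<0 t 0<z with Win⇒OneRound (sound s) (ℤₚ.<⇒≢ y<0)
      ... | + zero   , c≢0 , _ = ⊥-elim (c≢0 refl)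
      ... | + suc c  , _   , r = P.Positive.Win⇔multiple c r gap s y<0
      ... | -[1+ c ] , _   , r = λ x → mk⇔
              (mirror-∣ {x = x} ∘ equiv (- x) .Equivalence.to ∘ Win⇔mirror x .Equivalence.to)
              (Win⇔mirror x .Equivalence.from ∘ equiv (- x) .Equivalence.from ∘ unmirror-∣ {x = x})
        where
        equiv = P⁻.Positive.Win⇔multiple c (mirror-round { -[1+ c ]} r) (mirror-gap gap)
          (subst S (sym (ℤₚ.neg-involutive _)) t) (ℤₚ.neg-mono-< 0<z)

open IntegerGames
open import Data.Nat using (_+_; _*_; _^_; _∸_; _≤_; _<_; ⌊_/2⌋; ⌈_/2⌉)

-- The program

-- A unary number is a list of nils, that is, a bitmap without set bits, so
-- append# also adds numbers and pads bitmaps.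

sig : Signature
sig = 2 ∷ 2 ∷ 1 ∷ 1 ∷ 2 ∷ 2 ∷ 2 ∷ 3 ∷ 4 ∷ 5 ∷ 2 ∷ 1 ∷ 1 ∷ 3 ∷ 2 ∷ 3 ∷ 2 ∷ []

pattern append#  = zero
pattern drop#    = suc append#
pattern decode#  = suc drop#
pattern absSum#  = suc decode#
pattern shift#   = suc absSum#
pattern times#   = suc shift#
pattern any#     = suc times#
pattern all#     = suc any#
pattern scan#    = suc all#
pattern iterate# = suc scan#
pattern reverse# = suc iterate#
pattern inc#     = suc reverse#
pattern encode#  = suc inc#
pattern enum#    = suc encode#
pattern meets#   = suc enum#
pattern gap#     = suc meets#
pattern finish#  = suc gap#

-- The tree `nil · nil` has many readings: the set bit, the negative sign, the unary number 1, and
-- the codes of the natural number 1 and of the integer 0.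
oneᵉ : ∀ {n} → Expr sig n
oneᵉ = cons nil nil

tailᵉ : ∀ {n} → Expr sig n → Expr sig n
tailᵉ e = case e nil (var (# 1))

gapᵉ : ∀ {n} → Expr sig n → Expr sig n
gapᵉ s = call gap# (tailᵉ s ∷ s ∷ oneᵉ ∷ [])

-- The variables are the negative members, the positive members, the bitmap and the unary `B`. In
-- the digits 1 and 2 the tags 0 to 3 are `nil`, `oneᵉ`, `cons oneᵉ nil` and `cons nil oneᵉ`. The
-- innermost `cons nil nil` puts the integer 0 in front of the finite set.
describeᵉ : Expr sig 4
describeᵉ =
  case (var (# 1))
    (case (var (# 0))
      (cons nil nil)
      (cons (cons nil oneᵉ)
      (cons (gapᵉ (var (# 4)))
      (cons (cons oneᵉ (call encode# (var (# 5) ∷ [])))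
      (cons (cons nil nil) (var (# 2)))))))
    (case (var (# 2))
      (cons (cons oneᵉ nil)
      (cons (gapᵉ (var (# 4)))
      (cons (cons nil (call encode# (var (# 5) ∷ [])))
      (cons (cons nil nil) (var (# 3))))))
      (cons oneᵉ (gapᵉ (var (# 6)))))

body : (f : Fin (length sig)) → Expr sig (List.lookup sig f)
body append# = case (var (# 0)) (var (# 1))
  (cons (var (# 0)) (call append# (var (# 1) ∷ var (# 3) ∷ [])))
body drop# = case (var (# 0)) (var (# 1))
  (call drop# (var (# 1) ∷ tailᵉ (var (# 3)) ∷ []))
body decode# = case (var (# 0)) nil
  (bind (call decode# (var (# 1) ∷ []))
  (bind (call append# (var (# 0) ∷ var (# 0) ∷ []))
  (case (var (# 2)) (cons nil (var (# 0))) (cons nil (cons nil (var (# 2)))))))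
body absSum# = case (var (# 0)) nil
  (case (var (# 0)) nil
  (call append# (call decode# (var (# 1) ∷ []) ∷ call absSum# (var (# 3) ∷ []) ∷ [])))
body shift# = case (var (# 0)) nil
  (cons (case (var (# 0)) nil
          (case (var (# 0))
            (call append# (call decode# (var (# 1) ∷ []) ∷ var (# 5) ∷ []))
            (call drop# (call decode# (var (# 3) ∷ []) ∷ var (# 7) ∷ []))))
        (call shift# (var (# 1) ∷ var (# 3) ∷ [])))
body times# = case (var (# 0)) nil
  (call append# (var (# 3) ∷ call times# (var (# 1) ∷ var (# 3) ∷ []) ∷ []))
body any# = case (var (# 0)) nil
  (case (call drop# (var (# 0) ∷ var (# 3) ∷ []))
    (call any# (var (# 1) ∷ var (# 3) ∷ []))
    (case (var (# 0)) (call any# (var (# 3) ∷ var (# 5) ∷ [])) oneᵉ))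
body all# = case (var (# 0)) oneᵉ
  (case (call any# (var (# 3) ∷ call drop# (var (# 0) ∷ var (# 4) ∷ []) ∷ []))
    nil
    (call all# (var (# 3) ∷ var (# 5) ∷ var (# 6) ∷ [])))
body scan# = case (var (# 0)) nil
  (cons (case (var (# 0)) (call all# (var (# 5) ∷ var (# 4) ∷ var (# 3) ∷ [])) oneᵉ)
        (call scan# (var (# 1) ∷ tailᵉ (var (# 3)) ∷ var (# 4) ∷ var (# 5) ∷ [])))
body iterate# = case (var (# 0)) (var (# 1))
  (call iterate# (var (# 1)
    ∷ call scan# (var (# 3) ∷ call append# (var (# 4) ∷ var (# 3) ∷ [])
                   ∷ var (# 5) ∷ var (# 6) ∷ [])
    ∷ var (# 4) ∷ var (# 5) ∷ var (# 6) ∷ []))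
body reverse# = case (var (# 0)) (var (# 1))
  (call reverse# (var (# 1) ∷ cons (var (# 0)) (var (# 3)) ∷ []))
body inc# = case (var (# 0)) oneᵉ
  (case (var (# 0)) (cons oneᵉ (var (# 1))) (cons nil (call inc# (var (# 3) ∷ []))))
body encode# = case (var (# 0)) nil
  (call inc# (call encode# (var (# 1) ∷ []) ∷ []))
body enum# = case (var (# 0)) nil
  (case (var (# 0))
    (call enum# (var (# 1) ∷ var (# 3) ∷ call inc# (var (# 4) ∷ []) ∷ []))
    (cons (cons (var (# 5)) (var (# 6)))
          (call enum# (var (# 3) ∷ var (# 5) ∷ call inc# (var (# 6) ∷ []) ∷ []))))
body meets# = case (var (# 0)) nil
  (case (var (# 3)) nil
  (case (var (# 0)) (call meets# (var (# 3) ∷ var (# 1) ∷ []))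
  (case (var (# 4)) (call meets# (var (# 5) ∷ var (# 3) ∷ [])) oneᵉ)))
body gap# = case (var (# 0)) (var (# 2))
  (case (call meets# (var (# 3) ∷ var (# 2) ∷ []))
    (call gap# (var (# 1) ∷ var (# 3) ∷ call inc# (var (# 4) ∷ []) ∷ []))
    (var (# 6)))
body finish# =
  bind (call enum# (call drop# (cons nil (var (# 1)) ∷ var (# 0) ∷ []) ∷ nil ∷ oneᵉ ∷ []))
  (bind (call enum# (call drop# (cons nil (var (# 2))
          ∷ call reverse# (var (# 1) ∷ nil ∷ []) ∷ []) ∷ oneᵉ ∷ oneᵉ ∷ []))
  describeᵉ)

main : Expr sig 1
main = case (var (# 0)) nil
  (bind (cons nil (call append# (call absSum# (var (# 0) ∷ []) ∷ call absSum# (var (# 1) ∷ []) ∷ [])))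
  (bind (call shift# (var (# 1) ∷ var (# 0) ∷ []))
  (bind (call shift# (var (# 3) ∷ var (# 1) ∷ []))
  (bind (call append# (var (# 2) ∷ var (# 2) ∷ []))
  (bind (call append# (var (# 0) ∷ var (# 0) ∷ []))
  (bind (call times# (call times# (var (# 0) ∷ var (# 0) ∷ []) ∷ var (# 0) ∷ []))
  (bind (call append# (var (# 0) ∷ cons oneᵉ (var (# 0)) ∷ []))
  -- The initial bitmap doubles as the loop counter: as many steps as it has bits reach the fixed
  -- point.
  (bind (call iterate# (var (# 0) ∷ var (# 0) ∷ var (# 3) ∷ var (# 5) ∷ var (# 4) ∷ []))
  (call finish# (var (# 0) ∷ var (# 2) ∷ []))))))))))

program : Program
program = record { sig = sig ; body = body ; main = main }

-- Running times

mutual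
  -- Within one body no node is evaluated twice, so this bounds the evaluated nodes. A call counts
  -- for two: its own unit of time and the run of the called body.
  nodes : ∀ {S n} → Expr S n → ℕ
  nodes (var i)         = 1
  nodes nil             = 1
  nodes (cons e₁ e₂)    = suc (nodes e₁ + nodes e₂)
  nodes (case e e₁ e₂)  = suc (nodes e + (nodes e₁ + nodes e₂))
  nodes (bind e₁ e₂)    = suc (nodes e₁ + nodes e₂)
  nodes (call f es)     = suc (suc (nodes* es))

  nodes* : ∀ {S n m} → Vec (Expr S n) m → ℕ
  nodes* []       = 0
  nodes* (e ∷ es) = nodes e + nodes* es

infix 4 _⊢ᵖ_⇓_[_] _⊢ᵖ*_⇓_[_]

_⊢ᵖ_⇓_[_] : ∀ {n} → Vec Tree n → Expr sig n → Tree → ℕ → Set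
_⊢ᵖ_⇓_[_] = _⊢_⇓_[_] program

_⊢ᵖ*_⇓_[_] : ∀ {n m} → Vec Tree n → Vec (Expr sig n) m → Vec Tree m → ℕ → Set
ρ ⊢ᵖ* es ⇓ vs [ t ] = _⊢*_⇓_[_] program ρ es vs t

record CallWithin (f : Fin (length sig)) (vs : Vec Tree (List.lookup sig f)) (w : Tree) (T : ℕ) : Set where
  constructor within
  field
    {time} : ℕ
    run    : vs ⊢ᵖ body f ⇓ w [ time ]
    time≤  : time ≤ T

-- Any common bound for the bodies and `main` serves; this one is checked by evaluation.
maxNodes : ℕ
maxNodes = 300

nodes-body : ∀ f → nodes (body f) ≤ maxNodes
nodes-body = toWitness {a? = Finₚ.all? λ f → nodes (body f) ℕ.≤? maxNodes} _

module Cost (N : ℕ) (big : maxNodes ≤ N) where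

  -- Every call inside e costs at most N ^ a, except r marked ones (the
  -- recursive calls), which cost at most Y.
  record Runs {n} (a Y : ℕ) (ρ : Vec Tree n) (e : Expr sig n) (v : Tree) (r : ℕ) : Set where
    constructor runs
    field
      {time} : ℕ
      run    : ρ ⊢ᵖ e ⇓ v [ time ]
      time≤  : time ≤ nodes e * N ^ a + r * Y

  record Runs* {n m} (a Y : ℕ) (ρ : Vec Tree n) (es : Vec (Expr sig n) m) (vs : Vec Tree m) (r : ℕ) : Set where
    constructor runs*
    field
      {time} : ℕ
      run    : ρ ⊢ᵖ* es ⇓ vs [ time ]
      time≤  : time ≤ nodes* es * N ^ a + r * Y

  instance
    N-nonZero : NonZero N
    N-nonZero = ℕ.>-nonZero (ℕₚ.≤-trans (s≤s z≤n) big)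

  0<N^ : ∀ a → 1 ≤ N ^ a
  0<N^ a = ℕₚ.m^n>0 N a

  private
    gather : ∀ k l r s X Y → (k * X + r * Y) + (l * X + s * Y) ≡ (k + l) * X + (r + s) * Y
    gather = ℕSolver.solve-∀

    insert : ∀ l k X R → k * X + R ≤ (l + k) * X + R
    insert l k X R = ℕₚ.+-monoˡ-≤ R (ℕₚ.*-monoˡ-≤ X (ℕₚ.m≤n+m k l))

    +-gather : ∀ {t u k l r s X Y} → t ≤ k * X + r * Y → u ≤ l * X + s * Y →
               t + u ≤ (k + l) * X + (r + s) * Y
    +-gather {k = k} {l} {r} {s} {X} {Y} p q =
      ℕₚ.≤-trans (ℕₚ.+-mono-≤ p q) (ℕₚ.≤-reflexive (gather k l r s X Y))

    tick : ∀ {t R} a k → t ≤ k * N ^ a + R → suc t ≤ suc k * N ^ a + R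
    tick {R = R} a k p = ℕₚ.≤-trans (ℕₚ.+-mono-≤ (0<N^ a) p)
      (ℕₚ.≤-reflexive (sym (ℕₚ.+-assoc (N ^ a) (k * N ^ a) R)))

  record Calls (b : ℕ) (f : Fin (length sig)) (vs : Vec Tree (List.lookup sig f)) (w : Tree) : Set where
    constructor calls
    field
      bounded-call : CallWithin f vs w (N ^ b)

  module _ {a Y n : ℕ} {ρ : Vec Tree n} where

    var′ : ∀ {i} → Runs a Y ρ (var i) (Vec.lookup ρ i) 0
    var′ {i} = runs (var i) $ tick a 0 z≤n

    nil′ : Runs a Y ρ nil nil 0
    nil′ = runs nil $ tick a 0 z≤n

    cons′ : ∀ {e₁ e₂ v₁ v₂ r₁ r₂} → Runs a Y ρ e₁ v₁ r₁ → Runs a Y ρ e₂ v₂ r₂ →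
            Runs a Y ρ (cons e₁ e₂) (v₁ · v₂) (r₁ + r₂)
    cons′ {e₁} {e₂} {r₁ = r₁} (runs d p) (runs e q) =
      runs (cons d e) $ tick a (nodes e₁ + nodes e₂) (+-gather {k = nodes e₁} {nodes e₂} {r₁} p q)

    case-nil′ : ∀ {e e₁ e₂ w r₁ r₂} → Runs a Y ρ e nil r₁ → Runs a Y ρ e₁ w r₂ →
                Runs a Y ρ (case e e₁ e₂) w (r₁ + r₂)
    case-nil′ {e} {e₁} {e₂} {r₁ = r₁} {r₂} (runs d p) (runs d′ q) = runs (case-nil d d′) $
      tick a (nodes e + (nodes e₁ + nodes e₂)) (+-gather {k = nodes e} {nodes e₁ + nodes e₂} {r₁} p
        (ℕₚ.≤-trans q (ℕₚ.+-monoˡ-≤ (r₂ * Y) (ℕₚ.*-monoˡ-≤ (N ^ a) (ℕₚ.m≤m+n (nodes e₁) (nodes e₂))))))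

    case-cons′ : ∀ {e e₁ e₂ v₁ v₂ w r₁ r₂} → Runs a Y ρ e (v₁ · v₂) r₁ →
                 Runs a Y (v₁ ∷ v₂ ∷ ρ) e₂ w r₂ → Runs a Y ρ (case e e₁ e₂) w (r₁ + r₂)
    case-cons′ {e} {e₁} {e₂} {r₁ = r₁} {r₂} (runs d p) (runs d′ q) = runs (case-cons d d′) $
      tick a (nodes e + (nodes e₁ + nodes e₂)) (+-gather {k = nodes e} {nodes e₁ + nodes e₂} {r₁} p
        (ℕₚ.≤-trans q (insert (nodes e₁) (nodes e₂) (N ^ a) (r₂ * Y))))

    bind′ : ∀ {e₁ e₂ v w r₁ r₂} → Runs a Y ρ e₁ v r₁ → Runs a Y (v ∷ ρ) e₂ w r₂ →
            Runs a Y ρ (bind e₁ e₂) w (r₁ + r₂)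
    bind′ {e₁} {e₂} {r₁ = r₁} (runs d p) (runs e q) =
      runs (bind d e) $ tick a (nodes e₁ + nodes e₂) (+-gather {k = nodes e₁} {nodes e₂} {r₁} p q)

    []′ : Runs* a Y ρ [] [] 0
    []′ = runs* [] z≤n

    infixr 5 _∷′_
    _∷′_ : ∀ {m e v r₁ r₂} {es : Vec (Expr sig n) m} {vs} → Runs a Y ρ e v r₁ →
           Runs* a Y ρ es vs r₂ → Runs* a Y ρ (e ∷ es) (v ∷ vs) (r₁ + r₂)
    _∷′_ {e = e} {r₁ = r₁} {es = es} (runs d p) (runs* ds q) =
      runs* (d ∷ ds) $ +-gather {k = nodes e} {nodes* es} {r₁} p q

    call′ : ∀ {f es vs w b r} → Runs* a Y ρ es vs r → Calls b f vs w →
            {True (b ℕ.≤? a)} → Runs a Y ρ (call f es) w r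
    call′ {f} {es} {r = r} (runs* ds p) (calls (within d q)) {b≤a} = runs (call f ds d) $
      tick a (suc (nodes* es)) (ℕₚ.≤-trans (ℕₚ.+-mono-≤ p (ℕₚ.≤-trans q (ℕₚ.^-monoʳ-≤ N (toWitness b≤a))))
        (ℕₚ.≤-reflexive (regroup (nodes* es) r (N ^ a) Y)))
      where
      regroup : ∀ k r X Y → (k * X + r * Y) + X ≡ suc k * X + r * Y
      regroup = ℕSolver.solve-∀

    rec″ : ∀ {f es vs w r} → Runs* a Y ρ es vs r → CallWithin f vs w Y →
           Runs a Y ρ (call f es) w (suc r)
    rec″ {f} {es} {r = r} (runs* ds p) (within d q) = runs (call f ds d) $
      tick a (suc (nodes* es)) (ℕₚ.≤-trans (ℕₚ.+-mono-≤ p q)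
        (ℕₚ.≤-trans (ℕₚ.≤-reflexive (regroup (nodes* es) r (N ^ a) Y)) (insert 1 (nodes* es) (N ^ a) (suc r * Y))))
      where
      regroup : ∀ k r X Y → (k * X + r * Y) + Y ≡ k * X + suc r * Y
      regroup = ℕSolver.solve-∀

  -- There are at most `n` nested activations, each of which may spend `nodes (body f) * N ^ a`
  -- outside its recursive call.
  record Loop (a : ℕ) (f : Fin (length sig)) (vs : Vec Tree (List.lookup sig f)) (w : Tree) (n : ℕ) : Set where
    constructor loops
    field
      iterations : CallWithin f vs w (n * (nodes (body f) * N ^ a))

  rec′ : ∀ {a n m} {ρ : Vec Tree n} {f es vs w r} → Runs* a (m * (nodes (body f) * N ^ a)) ρ es vs r → Loop a f vs w m →
         Runs a (m * (nodes (body f) * N ^ a)) ρ (call f es) w (suc r)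
  rec′ ps (loops c) = rec″ ps c

  -- At most one marked call per activation, so the times of the activations add up instead of
  -- multiplying.
  loop : ∀ {a f vs w r} n → Runs a (n * (nodes (body f) * N ^ a)) vs (body f) w r →
         {True (r ℕ.≤? 1)} → Loop a f vs w (suc n)
  loop {a} {f} n (runs d p) {r≤1} = loops $ within d $ ℕₚ.≤-trans p
    (ℕₚ.+-monoʳ-≤ (nodes (body f) * N ^ a)
      (ℕₚ.≤-trans (ℕₚ.*-monoˡ-≤ (n * (nodes (body f) * N ^ a)) (toWitness r≤1))
        (ℕₚ.≤-reflexive (ℕₚ.*-identityˡ _))))

  -- One factor `N` for the number of activations and one for the nodes of the body: every level of
  -- nested loops raises the exponent by 2.
  bounded : ∀ {a f vs w n} → Loop a f vs w n → n ≤ N → Calls (2 + a) f vs w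
  bounded {a} {f} (loops (within d p)) n≤N = calls $ within d $ ℕₚ.≤-trans p
    (ℕₚ.*-mono-≤ n≤N (ℕₚ.*-monoˡ-≤ (N ^ a) (ℕₚ.≤-trans (nodes-body f) big)))

-- Meaning of the functions of the program

bit : Bool → Tree
bit false = nil
bit true  = one

list : {A : Set} → (A → Tree) → List A → Tree
list f []       = nil
list f (x ∷ xs) = f x · list f xs

bits : List Bool → Tree
bits = list bit

zeros : ℕ → List Bool
zeros n = replicate n false

unary : ℕ → Tree
unary n = bits (zeros n)

at : List Bool → ℕ → Bool
at []       i       = false
at (b ∷ bs) zero    = b
at (b ∷ bs) (suc i) = at bs i

-- This is w + m only if ∣ w ∣ ≤ m.
offset : ℕ → ℤ → ℕ
offset m (+ n)    = n + m
offset m -[1+ n ] = m ∸ suc n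

absSum : List ℤ → ℕ
absSum ws = sum (map ∣_∣ ws)

hits : List ℕ → List Bool → Bool
hits us s = any (at s) us

forces : List ℕ → List ℕ → List Bool → Bool
forces vs us s = all (λ v → hits us (drop v s)) vs

-- The second bitmap has p = 2 m more bits on the left, which compensates for the
-- offset m in each of the two moves of a round.
scan : List ℕ → List ℕ → List Bool → List Bool → List Bool
scan us vs []       s = []
scan us vs (b ∷ bs) s = (b ∨ forces vs us s) ∷ scan us vs bs (drop 1 s)

step : ℕ → List ℕ → List ℕ → List Bool → List Bool
step p us vs b = scan us vs b (zeros p ++ b)

iterate : ℕ → ℕ → List ℕ → List ℕ → List Bool → List Bool
iterate zero    p us vs b = b
iterate (suc n) p us vs b = iterate n p us vs (step p us vs b)

-- Bit `k` of a half stands for absolute value `k + 1`, as the middle bit, which stands for 0, is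
-- cut off.
signed : Bool → ℕ → ℤ
signed false k = + suc k
signed true  k = -[1+ k ]

enum : List Bool → Bool → ℕ → List ℤ
enum []           s k = []
enum (false ∷ bs) s k = enum bs s (suc k)
enum (true  ∷ bs) s k = signed s k ∷ enum bs s (suc k)

meets : List Bool → List Bool → Bool
meets []       ys       = false
meets (x ∷ xs) []       = false
meets (x ∷ xs) (y ∷ ys) = (x ∧ y) ∨ meets xs ys

-- The shift is suc k, so that the result cannot be 0.
gap : List Bool → List Bool → ℕ → ℕ
gap []      b k = k
gap (x ∷ s) b k = if meets b (x ∷ s) then k else gap s b (suc k)

describe : List Bool → ℕ → List ℤ → List ℤ → Description
describe s B []      []      = only-zero
describe s B []      (l ∷ L) = below (suc (gap (drop 1 s) s 0)) (ℤ.- (+ B)) (0ℤ ∷ l ∷ L)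
describe s B (r ∷ R) []      = above (suc (gap (drop 1 s) s 0)) (+ B) (0ℤ ∷ r ∷ R)
describe s B (_ ∷ _) (_ ∷ _) = multiples (suc (gap (drop 1 s) s 0))

-- Dropping `suc B` bits removes one half and the middle bit. Because the bitmap has `2 B + 1` bits,
-- its reversal has the value `-[1+ i ]` at position `B + 1 + i`.
rightOf leftOf : List Bool → ℕ → List ℤ
rightOf s B = enum (drop (suc B) s) false 0
leftOf  s B = enum (drop (suc B) (s ʳ++ [])) true 0

finish : List Bool → ℕ → Description
finish s B = describe s B (rightOf s B) (leftOf s B)

-- Elementary facts on offsets, lists and digits.

≤-sum : ∀ {A : Set} (f : A → ℕ) xs {x} → x ∈ xs → f x ≤ sum (map f xs)
≤-sum f (x ∷ xs) (here refl) = ℕₚ.m≤m+n (f x) _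
≤-sum f (x ∷ xs) (there x∈)  = ℕₚ.≤-trans (≤-sum f xs x∈) (ℕₚ.m≤n+m _ (f x))

offset≤ : ∀ K w → ∣ w ∣ ≤ K → offset K w ≤ K + K
offset≤ K (+ n)    le = ℕₚ.+-monoˡ-≤ K le
offset≤ K -[1+ n ] le = ℕₚ.≤-trans (ℕₚ.m∸n≤m K (suc n)) (ℕₚ.m≤m+n K K)

at-drop : ∀ k s i → at (drop k s) i ≡ at s (k + i)
at-drop zero    s       i = refl
at-drop (suc k) []      i = refl
at-drop (suc k) (b ∷ s) i = at-drop k s i

at-head : ∀ i s → at s i ≡ at (drop i s) 0
at-head i s = trans (cong (at s) (sym (ℕₚ.+-identityʳ i))) (sym (at-drop i s 0))

length-scan : ∀ us vs b s → length (scan us vs b s) ≡ length b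
length-scan us vs []      s = refl
length-scan us vs (_ ∷ b) s = cong suc (length-scan us vs b (drop 1 s))

length-iterate : ∀ n p us vs b → length (iterate n p us vs b) ≡ length b
length-iterate zero    p us vs b = refl
length-iterate (suc n) p us vs b =
  trans (length-iterate n p us vs (step p us vs b)) (length-scan us vs b (zeros p ++ b))

length-drop-≤ : ∀ {A : Set} k (xs : List A) → length (drop k xs) ≤ length xs
length-drop-≤ k xs = ℕₚ.≤-trans (ℕₚ.≤-reflexive (Listₚ.length-drop k xs)) (ℕₚ.m∸n≤m (length xs) k)

zeros-++ : ∀ m n → zeros m ++ zeros n ≡ zeros (m + n)
zeros-++ zero    n = refl
zeros-++ (suc m) n = cong (false ∷_) (zeros-++ m n)

drop-zeros : ∀ k n → drop k (zeros n) ≡ zeros (n ∸ k)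
drop-zeros zero    n       = refl
drop-zeros (suc k) zero    = refl
drop-zeros (suc k) (suc n) = drop-zeros k n

encodeℕ-suc : ∀ n → encodeℕ (suc n) ≡ encodeℕᵇ (ℕᵇ.suc (fromℕ n))
encodeℕ-suc n = cong encodeℕᵇ (trans (ℕᵇₚ.fromℕ≡fromℕ' (suc n)) (cong ℕᵇ.suc (sym (ℕᵇₚ.fromℕ≡fromℕ' n))))

digits : ℕᵇ → ℕ
digits ℕᵇ.zero   = 0
digits 2[1+ n ] = suc (digits n)
digits 1+[2 n ] = suc (digits n)

digits≤toℕ : ∀ b → digits b ≤ ℕᵇ.toℕ b
digits≤toℕ ℕᵇ.zero   = z≤n
digits≤toℕ 2[1+ n ] = ℕₚ.≤-trans (s≤s (digits≤toℕ n)) (ℕₚ.m≤m+n (suc (ℕᵇ.toℕ n)) _)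
digits≤toℕ 1+[2 n ] = s≤s (ℕₚ.≤-trans (digits≤toℕ n) (ℕₚ.m≤m+n (ℕᵇ.toℕ n) _))

-- Opaque, lest the type checker expand unary numbers of this size.
opaque
  square cube : ℕ → ℕ
  square q = q * q
  cube q   = q * q * q

  square≤cube : ∀ q → .{{NonZero q}} → square q ≤ cube q
  square≤cube q = ℕₚ.m≤m*n (q * q) q

  q≤cube : ∀ q → .{{NonZero q}} → q ≤ cube q
  q≤cube q = ℕₚ.m≤n*m q (q * q) {{ℕₚ.m*n≢0 q q}}

-- Results and running times of the functions of the program.

module Evaluation (N : ℕ) (big : maxNodes ≤ N) where
  open Cost N big

  append-loop : ∀ xs ys → Loop 0 append# (bits xs ∷ bits ys ∷ []) (bits (xs ++ ys)) (suc (length xs))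
  append-loop []       ys = loop 0 (case-nil′ var′ var′)
  append-loop (x ∷ xs) ys = loop _ (case-cons′ var′ (cons′ var′ (rec′ (var′ ∷′ var′ ∷′ []′) (append-loop xs ys))))

  append-call : ∀ xs ys → suc (length xs) ≤ N →
                Calls 2 append# (bits xs ∷ bits ys ∷ []) (bits (xs ++ ys)) 
  append-call xs ys = bounded (append-loop xs ys)

  add-call : ∀ m n → m < N → Calls 2 append# (unary m ∷ unary n ∷ []) (unary (m + n)) 
  add-call m n m<N = subst (λ l → Calls 2 append# (unary m ∷ unary n ∷ []) (bits l) ) (zeros-++ m n)
    (append-call (zeros m) (zeros n) (ℕₚ.≤-trans (s≤s (ℕₚ.≤-reflexive (length-replicate m))) m<N))

  drop-loop : ∀ k xs → Loop 0 drop# (unary k ∷ bits xs ∷ []) (bits (drop k xs)) (suc k)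
  drop-loop zero    xs       = loop 0 (case-nil′ var′ var′)
  drop-loop (suc k) []       = loop _ (case-cons′ var′ (rec′ (var′ ∷′ case-nil′ var′ nil′ ∷′ []′)
    (subst (λ l → Loop 0 drop# (unary k ∷ nil ∷ []) (bits l) (suc k)) (Listₚ.drop-[] k) (drop-loop k []))))
  drop-loop (suc k) (x ∷ xs) = loop _ (case-cons′ var′ (rec′ (var′ ∷′ case-cons′ var′ var′ ∷′ []′) (drop-loop k xs)))

  drop-call : ∀ k xs → k < N → Calls 2 drop# (unary k ∷ bits xs ∷ []) (bits (drop k xs)) 
  drop-call k xs = bounded (drop-loop k xs)

  decode-loop : ∀ b → ℕᵇ.toℕ b < N → Loop 2 decode# (encodeℕᵇ b ∷ []) (unary (ℕᵇ.toℕ b)) (suc (digits b))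
  decode-loop ℕᵇ.zero  _   = loop 0 (case-nil′ var′ nil′)
  decode-loop 1+[2 b ] <N rewrite ℕₚ.+-identityʳ (ℕᵇ.toℕ b) =
    loop _ (case-cons′ var′ (bind′ (rec′ (var′ ∷′ []′) (decode-loop b b<N))
      (bind′ (call′ (var′ ∷′ var′ ∷′ []′) (add-call (ℕᵇ.toℕ b) (ℕᵇ.toℕ b) b<N))
      (case-nil′ var′ (cons′ nil′ var′)))))
    where b<N = ℕₚ.≤-trans (s≤s (ℕₚ.≤-trans (ℕₚ.m≤m+n (ℕᵇ.toℕ b) (ℕᵇ.toℕ b)) (ℕₚ.n≤1+n _))) <N
  decode-loop 2[1+ b ] <N rewrite ℕₚ.+-identityʳ (ℕᵇ.toℕ b) | ℕₚ.+-suc (ℕᵇ.toℕ b) (ℕᵇ.toℕ b) =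
    loop _ (case-cons′ var′ (bind′ (rec′ (var′ ∷′ []′) (decode-loop b b<N))
      (bind′ (call′ (var′ ∷′ var′ ∷′ []′) (add-call (ℕᵇ.toℕ b) (ℕᵇ.toℕ b) b<N))
      (case-cons′ var′ (cons′ nil′ (cons′ nil′ var′))))))
    where b<N = ℕₚ.≤-trans (s≤s (ℕₚ.≤-trans (ℕₚ.m≤m+n (ℕᵇ.toℕ b) (ℕᵇ.toℕ b)) (ℕₚ.≤-trans (ℕₚ.n≤1+n _) (ℕₚ.n≤1+n _)))) <N

  decode-call : ∀ n → n < N → Calls 4 decode# (encodeℕ n ∷ []) (unary n) 
  decode-call n n<N = subst (λ k → Calls 4 decode# (encodeℕ n ∷ []) (unary k) ) (ℕᵇₚ.toℕ-fromℕ n)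
    (bounded (decode-loop (fromℕ n) eq) (ℕₚ.≤-trans (s≤s (digits≤toℕ (fromℕ n))) eq))
    where eq = subst (_< N) (sym (ℕᵇₚ.toℕ-fromℕ n)) n<N

  absSum-loop : ∀ ws → absSum ws < N → Loop 4 absSum# (encodeList ws ∷ []) (unary (absSum ws)) (suc (length ws))
  absSum-loop []             _  = loop 0 (case-nil′ var′ nil′)
  absSum-loop (+ n ∷ ws)     <N = loop _ (case-cons′ var′ (case-cons′ var′
    (call′ (call′ (var′ ∷′ []′) (decode-call n n<N) ∷′ rec′ (var′ ∷′ []′) (absSum-loop ws ws<N) ∷′ []′)
      (add-call n (absSum ws) n<N))))
    where n<N  = ℕₚ.≤-trans (s≤s (ℕₚ.m≤m+n n (absSum ws))) <N
          ws<N = ℕₚ.≤-trans (s≤s (ℕₚ.m≤n+m (absSum ws) n)) <N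
  absSum-loop (-[1+ n ] ∷ ws) <N = loop _ (case-cons′ var′ (case-cons′ var′
    (call′ (call′ (var′ ∷′ []′) (decode-call (suc n) n<N) ∷′ rec′ (var′ ∷′ []′) (absSum-loop ws ws<N) ∷′ []′)
      (add-call (suc n) (absSum ws) n<N))))
    where n<N  = ℕₚ.≤-trans (s≤s (ℕₚ.m≤m+n (suc n) (absSum ws))) <N
          ws<N = ℕₚ.≤-trans (s≤s (ℕₚ.m≤n+m (absSum ws) (suc n))) <N

  absSum-call : ∀ ws → absSum ws < N → length ws < N →
                Calls 6 absSum# (encodeList ws ∷ []) (unary (absSum ws)) 
  absSum-call ws <N = bounded (absSum-loop ws <N)

  shift-loop : ∀ ws m → absSum ws < N →
               Loop 4 shift# (encodeList ws ∷ unary m ∷ []) (list unary (map (offset m) ws)) (suc (length ws))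
  shift-loop []              m _  = loop 0 (case-nil′ var′ nil′)
  shift-loop (+ n ∷ ws)      m <N = loop _ (case-cons′ var′ (cons′
    (case-cons′ var′ (case-nil′ var′
      (call′ (call′ (var′ ∷′ []′) (decode-call n n<N) ∷′ var′ ∷′ []′) (add-call n m n<N))))
    (rec′ (var′ ∷′ var′ ∷′ []′) (shift-loop ws m ws<N))))
    where n<N  = ℕₚ.≤-trans (s≤s (ℕₚ.m≤m+n n (absSum ws))) <N
          ws<N = ℕₚ.≤-trans (s≤s (ℕₚ.m≤n+m (absSum ws) n)) <N
  shift-loop (-[1+ n ] ∷ ws) m <N = loop _ (case-cons′ var′ (cons′
    (case-cons′ var′ (case-cons′ var′
      (call′ (call′ (var′ ∷′ []′) (decode-call (suc n) n<N) ∷′ var′ ∷′ []′)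
        (subst (λ l → Calls 2 drop# (unary (suc n) ∷ unary m ∷ []) (bits l) ) (drop-zeros (suc n) m)
          (drop-call (suc n) (zeros m) n<N)))))
    (rec′ (var′ ∷′ var′ ∷′ []′) (shift-loop ws m ws<N))))
    where n<N  = ℕₚ.≤-trans (s≤s (ℕₚ.m≤m+n (suc n) (absSum ws))) <N
          ws<N = ℕₚ.≤-trans (s≤s (ℕₚ.m≤n+m (absSum ws) (suc n))) <N

  shift-call : ∀ ws m → absSum ws < N → length ws < N →
               Calls 6 shift# (encodeList ws ∷ unary m ∷ []) (list unary (map (offset m) ws)) 
  shift-call ws m <N = bounded (shift-loop ws m <N)

  times-loop : ∀ m n → n < N → Loop 2 times# (unary m ∷ unary n ∷ []) (unary (m * n)) (suc m)
  times-loop zero    n n<N = loop 0 (case-nil′ var′ nil′)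
  times-loop (suc m) n n<N = loop _ (case-cons′ var′
    (call′ (var′ ∷′ rec′ (var′ ∷′ var′ ∷′ []′) (times-loop m n n<N) ∷′ []′) (add-call n (m * n) n<N)))

  times-call : ∀ m n → m < N → n < N → Calls 4 times# (unary m ∷ unary n ∷ []) (unary (m * n)) 
  times-call m n m<N n<N = bounded (times-loop m n n<N) m<N

  Below : List ℕ → Set
  Below us = ∀ {u} → u ∈ us → u < N

  any-loop : ∀ us s → Below us → Loop 2 any# (list unary us ∷ bits s ∷ []) (bit (hits us s)) (suc (length us))
  any-loop []       s _  = loop 0 (case-nil′ var′ nil′)
  -- The run of `drop#` is abstracted along with its result, so that splitting the result also
  -- decides the branch taken.
  any-loop (u ∷ us) s <N rewrite at-head u s with drop u s | drop-call u s (<N (here refl))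
  ... | []         | dr = loop _ (case-cons′ var′ (case-nil′ (call′ (var′ ∷′ var′ ∷′ []′) dr)
        (rec′ (var′ ∷′ var′ ∷′ []′) (any-loop us s (<N ∘ there)))))
  ... | false ∷ s′ | dr = loop _ (case-cons′ var′ (case-cons′ (call′ (var′ ∷′ var′ ∷′ []′) dr)
        (case-nil′ var′ (rec′ (var′ ∷′ var′ ∷′ []′) (any-loop us s (<N ∘ there))))))
  ... | true ∷ s′  | dr = loop _ (case-cons′ var′ (case-cons′ (call′ (var′ ∷′ var′ ∷′ []′) dr)
        (case-cons′ var′ (cons′ nil′ nil′))))

  any-call : ∀ us s → Below us → length us < N →
             Calls 4 any# (list unary us ∷ bits s ∷ []) (bit (hits us s)) 
  any-call us s <N = bounded (any-loop us s <N)

  all-loop : ∀ vs us s → Below vs → Below us → length us < N →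
             Loop 4 all# (list unary vs ∷ list unary us ∷ bits s ∷ []) (bit (forces vs us s)) (suc (length vs))
  all-loop []       us s _   _   _   = loop 0 (case-nil′ var′ (cons′ nil′ nil′))
  all-loop (v ∷ vs) us s vs< us< len with hits us (drop v s) | any-call us (drop v s) us< len
  ... | false | an = loop _ (case-cons′ var′ (case-nil′
        (call′ (var′ ∷′ call′ (var′ ∷′ var′ ∷′ []′) (drop-call v s (vs< (here refl))) ∷′ []′) an) nil′))
  ... | true  | an = loop _ (case-cons′ var′ (case-cons′
        (call′ (var′ ∷′ call′ (var′ ∷′ var′ ∷′ []′) (drop-call v s (vs< (here refl))) ∷′ []′) an)
        (rec′ (var′ ∷′ var′ ∷′ var′ ∷′ []′) (all-loop vs us s (vs< ∘ there) us< len))))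

  module _ (us vs : List ℕ) (us< : Below us) (vs< : Below vs) (#us : length us < N) (#vs : length vs < N) where

    all-call : ∀ s → Calls 6 all# (list unary vs ∷ list unary us ∷ bits s ∷ []) (bit (forces vs us s)) 
    all-call s = bounded (all-loop vs us s vs< us< #us) #vs

    scan-loop : ∀ b s → Loop 6 scan# (bits b ∷ bits s ∷ list unary us ∷ list unary vs ∷ [])
                          (bits (scan us vs b s)) (suc (length b))
    scan-loop []      s = loop 0 (case-nil′ var′ nil′)
    scan-loop (true ∷ b) [] = loop _ (case-cons′ var′ (cons′ (case-cons′ var′ (cons′ nil′ nil′))
      (rec′ (var′ ∷′ case-nil′ var′ nil′ ∷′ var′ ∷′ var′ ∷′ []′) (scan-loop b []))))
    scan-loop (true ∷ b) (x ∷ s) = loop _ (case-cons′ var′ (cons′ (case-cons′ var′ (cons′ nil′ nil′))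
      (rec′ (var′ ∷′ case-cons′ var′ var′ ∷′ var′ ∷′ var′ ∷′ []′) (scan-loop b s))))
    scan-loop (false ∷ b) [] = loop _ (case-cons′ var′ (cons′
      (case-nil′ var′ (call′ (var′ ∷′ var′ ∷′ var′ ∷′ []′) (all-call [])))
      (rec′ (var′ ∷′ case-nil′ var′ nil′ ∷′ var′ ∷′ var′ ∷′ []′) (scan-loop b []))))
    scan-loop (false ∷ b) (x ∷ s) = loop _ (case-cons′ var′ (cons′
      (case-nil′ var′ (call′ (var′ ∷′ var′ ∷′ var′ ∷′ []′) (all-call (x ∷ s))))
      (rec′ (var′ ∷′ case-cons′ var′ var′ ∷′ var′ ∷′ var′ ∷′ []′) (scan-loop b s))))

    scan-call : ∀ b s → length b < N → Calls 8 scan# (bits b ∷ bits s ∷ list unary us ∷ list unary vs ∷ [])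
                          (bits (scan us vs b s)) 
    scan-call b s = bounded (scan-loop b s)

    iterate-loop : ∀ xs b p → length b < N → p < N →
      Loop 8 iterate# (bits xs ∷ bits b ∷ unary p ∷ list unary us ∷ list unary vs ∷ [])
        (bits (iterate (length xs) p us vs b)) (suc (length xs))
    iterate-loop []       b p _   _   = loop 0 (case-nil′ var′ var′)
    iterate-loop (_ ∷ xs) b p b<N p<N = loop _ (case-cons′ var′ (rec′
      (var′ ∷′ call′ (var′ ∷′ call′ (var′ ∷′ var′ ∷′ []′)
          (append-call (zeros p) b (subst (_< N) (sym (length-replicate p)) p<N)) ∷′ var′ ∷′ var′ ∷′ []′)
          (scan-call b (zeros p ++ b) b<N)
        ∷′ var′ ∷′ var′ ∷′ var′ ∷′ []′)
      (iterate-loop xs (step p us vs b) p (subst (_< N) (sym (length-scan us vs b _)) b<N) p<N)))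

    iterate-call : ∀ b p → length b < N → p < N →
      Calls 10 iterate# (bits b ∷ bits b ∷ unary p ∷ list unary us ∷ list unary vs ∷ [])
        (bits (iterate (length b) p us vs b)) 
    iterate-call b p b<N p<N = bounded (iterate-loop b b p b<N p<N) b<N

  reverse-loop : ∀ xs acc → Loop 0 reverse# (bits xs ∷ bits acc ∷ []) (bits (xs ʳ++ acc)) (suc (length xs))
  reverse-loop []       acc = loop 0 (case-nil′ var′ var′)
  reverse-loop (x ∷ xs) acc = loop _ (case-cons′ var′ (rec′ (var′ ∷′ cons′ var′ var′ ∷′ []′) (reverse-loop xs (x ∷ acc))))

  inc-loop : ∀ b → Loop 0 inc# (encodeℕᵇ b ∷ []) (encodeℕᵇ (ℕᵇ.suc b)) (suc (digits b))
  inc-loop ℕᵇ.zero  = loop 0 (case-nil′ var′ (cons′ nil′ nil′))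
  inc-loop 1+[2 b ] = loop _ (case-cons′ var′ (case-nil′ var′ (cons′ (cons′ nil′ nil′) var′)))
  inc-loop 2[1+ b ] = loop _ (case-cons′ var′ (case-cons′ var′ (cons′ nil′ (rec′ (var′ ∷′ []′) (inc-loop b)))))

  inc-call : ∀ n → n < N → Calls 2 inc# (encodeℕ n ∷ []) (encodeℕ (suc n)) 
  inc-call n n<N = subst (λ w → Calls 2 inc# (encodeℕ n ∷ []) w ) (sym (encodeℕ-suc n))
    (bounded (inc-loop (fromℕ n))
      (ℕₚ.≤-trans (s≤s (ℕₚ.≤-trans (digits≤toℕ (fromℕ n)) (ℕₚ.≤-reflexive (ℕᵇₚ.toℕ-fromℕ n)))) n<N))

  encode-loop : ∀ n → n < N → Loop 2 encode# (unary n ∷ []) (encodeℕ n) (suc n)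
  encode-loop zero    _   = loop 0 (case-nil′ var′ nil′)
  encode-loop (suc n) n<N = loop _ (case-cons′ var′
    (call′ (rec′ (var′ ∷′ []′) (encode-loop n n<N′) ∷′ []′) (inc-call n n<N′)))
    where n<N′ = ℕₚ.<-trans (ℕₚ.n<1+n n) n<N

  encode-call : ∀ n → n < N → Calls 4 encode# (unary n ∷ []) (encodeℕ n) 
  encode-call n n<N = bounded (encode-loop n n<N) n<N

  encodeℤ-signed : ∀ s k → encodeℤ (signed s k) ≡ bit s · encodeℕ (suc k)
  encodeℤ-signed false k = refl
  encodeℤ-signed true  k = refl

  enum-loop : ∀ bs s k → length bs + suc k < N →
    Loop 2 enum# (bits bs ∷ bit s ∷ encodeℕ (suc k) ∷ []) (encodeList (enum bs s k)) (suc (length bs))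
  enum-loop []           s k _  = loop 0 (case-nil′ var′ nil′)
  enum-loop (false ∷ bs) s k <N = loop _ (case-cons′ var′ (case-nil′ var′
    (rec′ (var′ ∷′ var′ ∷′ call′ (var′ ∷′ []′) (inc-call (suc k) k<N) ∷′ []′) (enum-loop bs s (suc k) bs<N))))
    where bs<N = subst (_< N) (sym (ℕₚ.+-suc (length bs) (suc k))) <N
          k<N  = ℕₚ.≤-trans (s≤s (ℕₚ.m≤n+m (suc k) (suc (length bs)))) <N
  enum-loop (true  ∷ bs) s k <N rewrite encodeℤ-signed s k = loop _ (case-cons′ var′ (case-cons′ var′
    (cons′ (cons′ var′ var′)
    (rec′ (var′ ∷′ var′ ∷′ call′ (var′ ∷′ []′) (inc-call (suc k) k<N) ∷′ []′) (enum-loop bs s (suc k) bs<N)))))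
    where bs<N = subst (_< N) (sym (ℕₚ.+-suc (length bs) (suc k))) <N
          k<N  = ℕₚ.≤-trans (s≤s (ℕₚ.m≤n+m (suc k) (suc (length bs)))) <N

  enum-call : ∀ bs s → suc (length bs) < N →
    Calls 4 enum# (bits bs ∷ bit s ∷ one ∷ []) (encodeList (enum bs s 0)) 
  enum-call bs s <N = bounded (enum-loop bs s 0 (subst (_< N) (ℕₚ.+-comm 1 (length bs)) <N)) (ℕₚ.<⇒≤ <N)

  meets-loop : ∀ xs ys → Loop 0 meets# (bits xs ∷ bits ys ∷ []) (bit (meets xs ys)) (suc (length xs))
  meets-loop []           ys           = loop 0 (case-nil′ var′ nil′)
  meets-loop (x ∷ xs)     []           = loop _ (case-cons′ var′ (case-nil′ var′ nil′))
  meets-loop (false ∷ xs) (false ∷ ys) = loop _ (case-cons′ var′ (case-cons′ var′ (case-nil′ var′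
    (rec′ (var′ ∷′ var′ ∷′ []′) (meets-loop xs ys)))))
  meets-loop (true ∷ xs)  (false ∷ ys) = loop _ (case-cons′ var′ (case-cons′ var′ (case-nil′ var′
    (rec′ (var′ ∷′ var′ ∷′ []′) (meets-loop xs ys)))))
  meets-loop (false ∷ xs) (true ∷ ys)  = loop _ (case-cons′ var′ (case-cons′ var′ (case-cons′ var′ (case-nil′ var′
    (rec′ (var′ ∷′ var′ ∷′ []′) (meets-loop xs ys))))))
  meets-loop (true ∷ xs)  (true ∷ ys)  = loop _ (case-cons′ var′ (case-cons′ var′ (case-cons′ var′ (case-cons′ var′
    (cons′ nil′ nil′)))))

  gap-loop : ∀ s b k → length s + suc k < N → length b < N →
    Loop 2 gap# (bits s ∷ bits b ∷ encodeℕ (suc k) ∷ []) (encodeℕ (suc (gap s b k))) (suc (length s))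
  gap-loop []      b k _  _ = loop 0 (case-nil′ var′ var′)
  gap-loop (x ∷ s) b k <N b<N with meets b (x ∷ s) | bounded {f = meets#} (meets-loop b (x ∷ s)) b<N
  ... | true  | ov = loop _ (case-cons′ var′ (case-cons′ (call′ (var′ ∷′ var′ ∷′ []′) ov) var′))
  ... | false | ov = loop _ (case-cons′ var′ (case-nil′ (call′ (var′ ∷′ var′ ∷′ []′) ov)
    (rec′ (var′ ∷′ var′ ∷′ call′ (var′ ∷′ []′) (inc-call (suc k) k<N) ∷′ []′) (gap-loop s b (suc k) s<N b<N))))
    where s<N = subst (_< N) (sym (ℕₚ.+-suc (length s) (suc k))) <N
          k<N = ℕₚ.≤-trans (s≤s (ℕₚ.m≤n+m (suc k) (suc (length s)))) <N

  gap-call : ∀ s b → suc (length s) < N → length b < N →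
    Calls 4 gap# (bits s ∷ bits b ∷ one ∷ []) (encodeℕ (suc (gap s b 0))) 
  gap-call s b <N b<N = bounded (gap-loop s b 0 (subst (_< N) (ℕₚ.+-comm 1 (length s)) <N) b<N) (ℕₚ.<⇒≤ <N)

  tail-runs : ∀ {a Y n} {ρ : Vec Tree n} {e} s → Runs a Y ρ e (bits s) 0 → Runs a Y ρ (tailᵉ e) (bits (drop 1 s)) 0
  tail-runs []      p = case-nil′ p nil′
  tail-runs (_ ∷ s) p = case-cons′ p var′

  gap-runs : ∀ {Y n} {ρ : Vec Tree n} {e} s → suc (length s) < N → Runs 4 Y ρ e (bits s) 0 →
             Runs 4 Y ρ (gapᵉ e) (encodeℕ (suc (gap (drop 1 s) s 0))) 0
  gap-runs s <N p = call′ (tail-runs s p ∷′ p ∷′ cons′ nil′ nil′ ∷′ []′)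
    (gap-call (drop 1 s) s (ℕₚ.≤-trans (s≤s (s≤s (length-drop-≤ 1 s))) <N) (ℕₚ.<⇒≤ <N))

  opaque
    unfolding square cube

    square-call : ∀ q → q < N → Calls 4 times# (unary q ∷ unary q ∷ []) (unary (square q))
    square-call q q<N = times-call q q q<N q<N

    cube-call : ∀ q → q < N → square q < N → Calls 4 times# (unary (square q) ∷ unary q ∷ []) (unary (cube q))
    cube-call q q<N r<N = times-call (q * q) q r<N q<N

  describe-runs : ∀ s B R L → .{{NonZero B}} → suc (length s) < N → B < N →
    Runs 4 0 (encodeList L ∷ encodeList R ∷ bits s ∷ unary B ∷ []) describeᵉ
      (encodeDescription (describe s B R L)) 0
  describe-runs s B [] [] s<N B<N = case-nil′ var′ (case-nil′ var′ (cons′ nil′ nil′))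
  -- Here `B` must be positive: a negative sign before the code of 0 encodes no integer.
  describe-runs s (suc B) [] (l ∷ L) s<N B<N = case-nil′ var′ (case-cons′ var′
    (cons′ (cons′ nil′ (cons′ nil′ nil′)) (cons′ (gap-runs s s<N var′)
      (cons′ (cons′ (cons′ nil′ nil′) (call′ (var′ ∷′ []′) (encode-call (suc B) B<N)))
        (cons′ (cons′ nil′ nil′) var′)))))
  describe-runs s B (r ∷ R) [] s<N B<N = case-cons′ var′ (case-nil′ var′
    (cons′ (cons′ (cons′ nil′ nil′) nil′) (cons′ (gap-runs s s<N var′)
      (cons′ (cons′ nil′ (call′ (var′ ∷′ []′) (encode-call B B<N)))
        (cons′ (cons′ nil′ nil′) var′)))))
  describe-runs s B (r ∷ R) (l ∷ L) s<N B<N = case-cons′ var′ (case-cons′ var′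
    (cons′ (cons′ nil′ nil′) (gap-runs s s<N var′)))

  once : ∀ {a f vs w} → Runs a 0 vs (body f) w 0 → Calls (2 + a) f vs w
  once r = bounded (loop 0 r) (ℕₚ.≤-trans (s≤s z≤n) big)

  finish-call : ∀ s B → .{{NonZero B}} → suc (length s) < N → suc B < N →
                Calls 6 finish# (bits s ∷ unary B ∷ []) (encodeDescription (finish s B))
  finish-call s B s<N B<N = once (bind′
    (call′ (call′ (cons′ nil′ var′ ∷′ var′ ∷′ []′) (drop-call (suc B) s B<N) ∷′ nil′ ∷′ cons′ nil′ nil′ ∷′ []′)
      (enum-call (drop (suc B) s) false (ℕₚ.≤-trans (s≤s (s≤s (length-drop-≤ (suc B) s))) s<N)))
    (bind′ (call′ (call′ (cons′ nil′ var′ ∷′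
          call′ (var′ ∷′ nil′ ∷′ []′) (bounded (reverse-loop s []) (ℕₚ.<⇒≤ s<N)) ∷′ []′)
        (drop-call (suc B) (s ʳ++ []) B<N) ∷′ cons′ nil′ nil′ ∷′ cons′ nil′ nil′ ∷′ []′)
      (enum-call (drop (suc B) (s ʳ++ [])) true
        (ℕₚ.≤-trans (s≤s (s≤s (ℕₚ.≤-trans (length-drop-≤ (suc B) (s ʳ++ []))
          (ℕₚ.≤-reflexive (trans (Listₚ.length-ʳ++ s) (ℕₚ.+-identityʳ (length s))))))) s<N)))
    (describe-runs s B _ _ s<N (ℕₚ.<⇒≤ B<N))))

  -- All intermediate results are variables, so no number or bitmap of the actual size appears while
  -- the derivation is assembled. The exponent 10 is that of `iterate#`.
  main-runs : ∀ {u v a b m us vs p q r B i s w} →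
    Calls 6 absSum# (u ∷ []) a → Calls 6 absSum# (v ∷ []) b → Calls 2 append# (a ∷ b ∷ []) m →
    Calls 6 shift# (u ∷ (nil · m) ∷ []) us → Calls 6 shift# (v ∷ (nil · m) ∷ []) vs →
    Calls 2 append# ((nil · m) ∷ (nil · m) ∷ []) p → Calls 2 append# (p ∷ p ∷ []) q →
    Calls 4 times# (q ∷ q ∷ []) r → Calls 4 times# (r ∷ q ∷ []) B → Calls 2 append# (B ∷ (one · B) ∷ []) i →
    Calls 10 iterate# (i ∷ i ∷ p ∷ us ∷ vs ∷ []) s → Calls 6 finish# (s ∷ B ∷ []) w →
    Runs 10 0 ((u · v) ∷ []) main w 0
  main-runs cu cv cm cus cvs cp cq cr cB ci cs cw = case-cons′ var′
    (bind′ (cons′ nil′ (call′ (call′ (var′ ∷′ []′) cu ∷′ call′ (var′ ∷′ []′) cv ∷′ []′) cm))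
    (bind′ (call′ (var′ ∷′ var′ ∷′ []′) cus)
    (bind′ (call′ (var′ ∷′ var′ ∷′ []′) cvs)
    (bind′ (call′ (var′ ∷′ var′ ∷′ []′) cp)
    (bind′ (call′ (var′ ∷′ var′ ∷′ []′) cq)
    (bind′ (call′ (call′ (var′ ∷′ var′ ∷′ []′) cr ∷′ var′ ∷′ []′) cB)
    (bind′ (call′ (var′ ∷′ cons′ (cons′ nil′ nil′) var′ ∷′ []′) ci)
    (bind′ (call′ (var′ ∷′ var′ ∷′ var′ ∷′ var′ ∷′ var′ ∷′ []′) cs)
    (call′ (var′ ∷′ var′ ∷′ []′) cw)))))))))

  -- The eleventh factor `N` pays for the nodes of `main`.
  main-runs-time : ∀ {i o} → Runs 10 0 (i ∷ []) main o 0 → ∃[ t ] OnInput_Returns_InTime_ program i o t × t ≤ N ^ 11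
  main-runs-time (runs d p) = _ , d , ℕₚ.≤-trans p (ℕₚ.≤-trans (ℕₚ.≤-reflexive (ℕₚ.+-identityʳ _))
    (ℕₚ.*-monoˡ-≤ (N ^ 10) (ℕₚ.≤-trans (toWitness {a? = nodes main ℕ.≤? maxNodes} _) big)))

-- The constants of a game and the run of the program on it.

module _ (G : RobotGame) where
  open RobotGame G

  -- Bit i of a bitmap stands for the counter value i - halfWindow.
  bound halfWindow : ℕ
  bound      = suc (absSum U + absSum V)
  halfWindow = cube ((bound + bound) + (bound + bound))

  offsetsU offsetsV : List ℕ
  offsetsU = map (offset bound) U
  offsetsV = map (offset bound) V

  initial : List Bool
  initial = zeros halfWindow ++ true ∷ zeros halfWindow

  solution : List Bool
  solution = iterate (length initial) (bound + bound) offsetsU offsetsV initial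

  answer : Description
  answer = finish solution halfWindow

  length-initial : length initial ≡ suc (halfWindow + halfWindow)
  length-initial = trans (Listₚ.length-++ (zeros halfWindow))
    (trans (cong₂ (λ a b → a + suc b) (length-replicate halfWindow) (length-replicate halfWindow))
      (ℕₚ.+-suc halfWindow halfWindow))

  bound≤halfWindow : (bound + bound) + (bound + bound) ≤ halfWindow
  bound≤halfWindow = q≤cube ((bound + bound) + (bound + bound))

  offset-sum≤ : ∀ ws {u} → absSum ws ≤ bound → u ∈ map (offset bound) ws → u ≤ bound + bound
  offset-sum≤ ws le u∈ with ∈-map⁻ (offset bound) u∈
  ... | w , w∈ , refl = offset≤ bound w (ℕₚ.≤-trans (≤-sum ∣_∣ ws w∈) le)

  module _ (N : ℕ) (big : maxNodes ≤ N) (window< : 4 + (halfWindow + halfWindow) ≤ N)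
           (#U : length U < N) (#V : length V < N) where
    open Cost N big
    open Evaluation N big

    private
      four : ℕ
      four = (bound + bound) + (bound + bound)
      half<  : 2 + halfWindow ≤ N
      half<  = ℕₚ.≤-trans (s≤s (s≤s (ℕₚ.≤-trans (ℕₚ.m≤m+n halfWindow halfWindow) (ℕₚ.m≤n+m _ 2)))) window<
      four<  : (bound + bound) + (bound + bound) < N
      four<  = ℕₚ.≤-trans (s≤s (ℕₚ.≤-trans bound≤halfWindow (ℕₚ.n≤1+n _))) half<
      two<   : bound + bound < N
      two<   = ℕₚ.≤-trans (s≤s (ℕₚ.m≤m+n (bound + bound) (bound + bound))) four<
      bound< : bound < N
      bound< = ℕₚ.≤-trans (s≤s (ℕₚ.m≤m+n bound bound)) two<
      U≤     : absSum U ≤ bound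
      U≤     = ℕₚ.≤-trans (ℕₚ.m≤m+n (absSum U) (absSum V)) (ℕₚ.n≤1+n _)
      V≤     : absSum V ≤ bound
      V≤     = ℕₚ.≤-trans (ℕₚ.m≤n+m (absSum V) (absSum U)) (ℕₚ.n≤1+n _)
      square<  : square ((bound + bound) + (bound + bound)) < N
      square<  = ℕₚ.≤-trans (s≤s (ℕₚ.≤-trans (square≤cube _) (ℕₚ.n≤1+n _))) half<
      instance
        halfWindow-nonZero : NonZero halfWindow
        halfWindow-nonZero = ℕ.>-nonZero (ℕₚ.≤-trans (s≤s z≤n) bound≤halfWindow)
      initial< : length initial < N
      initial< = subst (_< N) (sym length-initial) (ℕₚ.≤-trans (s≤s (s≤s (ℕₚ.m≤n+m _ 2))) window<)
      solution< : suc (length solution) < N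
      solution< = subst (λ l → suc l < N)
        (sym (trans (length-iterate (length initial) (bound + bound) offsetsU offsetsV initial) length-initial))
        (ℕₚ.≤-trans (s≤s (s≤s (s≤s (ℕₚ.n≤1+n _)))) window<)
      #offsetsU : length offsetsU < N
      #offsetsU = subst (_< N) (sym (Listₚ.length-map (offset bound) U)) #U
      #offsetsV : length offsetsV < N
      #offsetsV = subst (_< N) (sym (Listₚ.length-map (offset bound) V)) #V

      initial-call : Calls 2 append# (unary halfWindow ∷ (one · unary halfWindow) ∷ []) (bits initial)
      initial-call = append-call (zeros halfWindow) (true ∷ zeros halfWindow)
        (subst (λ l → suc l ≤ N) (sym (length-replicate halfWindow)) (ℕₚ.≤-trans (ℕₚ.n≤1+n _) half<))

    main-time : ∃[ t ] OnInput_Returns_InTime_ program (encodeGame G) (encodeDescription answer) t × t ≤ N ^ 11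
    main-time = main-runs-time (main-runs (absSum-call U (ℕₚ.≤-trans (s≤s U≤) bound<) #U) (absSum-call V (ℕₚ.≤-trans (s≤s V≤) bound<) #V)
      (add-call (absSum U) (absSum V) (ℕₚ.≤-trans (s≤s U≤) bound<))
      (shift-call U bound (ℕₚ.≤-trans (s≤s U≤) bound<) #U) (shift-call V bound (ℕₚ.≤-trans (s≤s V≤) bound<) #V)
      (add-call bound bound bound<) (add-call (bound + bound) (bound + bound) two<)
      (square-call four four<) (cube-call four four< square<) initial-call
      (iterate-call offsetsU offsetsV
        (λ i → ℕₚ.≤-trans (s≤s (offset-sum≤ U U≤ i)) two<) (λ i → ℕₚ.≤-trans (s≤s (offset-sum≤ V V≤ i)) two<)
        #offsetsU #offsetsV initial (bound + bound) initial< two<)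
      (finish-call solution halfWindow solution< half<))

-- Strategies

some : ∀ {A : Set} {xs : List A} → xs ≢ [] → Fin (length xs)
some {xs = []}     ≢[] = ⊥-elim (≢[] refl)
some {xs = x ∷ xs} ≢[] = zero

module Strategies (G : RobotGame) where
  open RobotGame G

  weight : Fin (length V) → Fin (length U) → ℤ
  weight i j = List.lookup V i ℤ.+ List.lookup U j

  open Game weight

  -- The reacher's memory is the part of the derivation still to be played. Strategies see prefixes
  -- only, so this memory has to be recomputed from the moves made.
  next : (∃[ y ] Win y) → Move G V → ∃[ y ] Win y
  next (_ , won)    _        = _ , won
  next (_ , move f) (v , v∈) = _ , proj₂ (f (Any.index v∈))

  reply : (∃[ y ] Win y) → Move G V → Move G U
  -- The play is already won, and any move will do.
  reply (_ , won)    _        = _ , ∈-lookup (some U-nonempty)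
  reply (_ , move f) (v , v∈) = _ , ∈-lookup (proj₁ (f (Any.index v∈)))

  -- The moves of the reacher are ignored: they are replies of the strategy.
  history : (∃[ y ] Win y) → List (Round G) → ∃[ y ] Win y
  history s []             = s
  history s ((v , _) ∷ rs) = next (history s rs) v

  strategy : (∃[ y ] Win y) → ReacherStrategy G
  strategy s (_ , rs) = reply (history s rs)

  Win⇒Winning : ∀ {x} → Win x → Winning G x
  Win⇒Winning {x} a = σ , λ τ → follow τ 0 a refl refl
    where
    σ = strategy (x , a)
    -- Recursion on the derivation `b` that remains after `k` rounds: every further round passes to
    -- a subderivation.
    follow : ∀ τ k {y} (b : Win y) → history (x , a) (rounds G σ τ x k) ≡ (y , b) →
             counter G (x , rounds G σ τ x k) ≡ y → WinsPlay G σ τ x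
    follow τ k won            _   eq = k , eq
    follow τ k {y} (move f) hist eq = follow τ (suc k) (proj₂ (f i)) (cong (λ h → next h v) hist) counter≡
      where
      v = τ (x , rounds G σ τ x k)
      i = Any.index (proj₂ v)
      counter≡ : counter G (x , rounds G σ τ x (suc k)) ≡ y ℤ.+ weight i (proj₁ (f i))
      counter≡ = trans
        (cong₂ (λ z h → z ℤ.+ proj₁ v ℤ.+ proj₁ (reply h v)) eq hist)
        (trans (ℤₚ.+-assoc y (proj₁ v) _)
          (cong (λ t → y ℤ.+ (t ℤ.+ List.lookup U (proj₁ (f i)))) (Anyₚ.lookup-index (proj₂ v))))

  module _ {D : ℤ → Set} (D? : ∀ x → Dec (D x)) (D⇔Win : ∀ x → Win x ⇔ D x) where
    open Equivalence

    -- Outside `D` some move of the opponent leaves no reply into `D`. It is found by a finite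
    -- search, which is where decidability of `D` enters.
    spoil : ∀ y → ∃[ i ] (¬ D y → ∀ j → ¬ D (y ℤ.+ weight i j))
    spoil y with Finₚ.all? (λ i → Finₚ.any? (λ j → D? (y ℤ.+ weight i j)))
    ... | yes f = some V-nonempty , λ ¬d → ⊥-elim (¬d (D⇔Win y .to (move λ i → proj₁ (f i) , D⇔Win _ .from (proj₂ (f i)))))
    ... | no ¬f with Finₚ.¬∀⟶∃¬ _ _ (λ i → Finₚ.any? (λ j → D? (y ℤ.+ weight i j))) ¬f
    ...   | i , ¬g = i , λ _ j d → ¬g (j , d)

    Winning⇒D : ∀ {x} → Winning G x → D x
    -- 0 lies in `D`, so a play that stays outside `D` never ends a round at 0.
    Winning⇒D {x} (σ , wins) = decidable-stable (D? x) λ ¬d →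
      avoid ¬d (proj₁ (wins τ)) (subst D (sym (proj₂ (wins τ))) (D⇔Win 0ℤ .to won))
      where
      τ : OpponentStrategy G
      τ p = _ , ∈-lookup (proj₁ (spoil (counter G p)))
      avoid : ¬ D x → ∀ k → ¬ D (counter G (x , rounds G σ τ x k))
      avoid ¬d zero    = ¬d
      avoid ¬d (suc k) = proj₂ (spoil y) (avoid ¬d k) j ∘ subst D
        (trans (ℤₚ.+-assoc y v _) (cong (λ t → y ℤ.+ (v ℤ.+ t)) (Anyₚ.lookup-index (proj₂ u))))
        where
        y = counter G (x , rounds G σ τ x k)
        v = List.lookup V (proj₁ (spoil y))
        u = σ (x , rounds G σ τ x k) (τ (x , rounds G σ τ x k))
        j = Any.index (proj₂ u)

    Winning⇔D : ∀ x → Winning G x ⇔ D x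
    Winning⇔D x = mk⇔ Winning⇒D (Win⇒Winning ∘ D⇔Win x .from)

-- Bitmaps

at-< : ∀ bs i → at bs i ≡ true → i < length bs
at-< (b ∷ bs) zero    _  = s≤s z≤n
at-< (b ∷ bs) (suc i) eq = s≤s (at-< bs i eq)

at-≡ : ∀ xs ys → length xs ≡ length ys → (∀ i → at xs i ≡ at ys i) → xs ≡ ys
at-≡ []       []       _   _  = refl
at-≡ (x ∷ xs) (y ∷ ys) len eq = cong₂ _∷_ (eq 0) (at-≡ xs ys (ℕₚ.suc-injective len) (eq ∘ suc))

at-ʳ++-length : ∀ xs ys k → at (xs ʳ++ ys) (length xs + k) ≡ at ys k
at-ʳ++-length []       ys k = refl
at-ʳ++-length (x ∷ xs) ys k =
  trans (cong (at (xs ʳ++ (x ∷ ys))) (sym (ℕₚ.+-suc (length xs) k))) (at-ʳ++-length xs (x ∷ ys) (suc k))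

at-ʳ++ : ∀ xs ys i j → i + suc j ≡ length xs → at (xs ʳ++ ys) i ≡ at xs j
at-ʳ++ []       ys i j       eq = ⊥-elim (ℕₚ.1+n≢0 (trans (sym (ℕₚ.+-suc i j)) eq))
at-ʳ++ (x ∷ xs) ys i zero    eq = trans (cong (at (xs ʳ++ (x ∷ ys))) i≡) (at-ʳ++-length xs (x ∷ ys) 0)
  where i≡ : i ≡ length xs + 0
        i≡ = trans (ℕₚ.suc-injective (trans (ℕₚ.+-comm 1 i) eq)) (sym (ℕₚ.+-identityʳ _))
at-ʳ++ (x ∷ xs) ys i (suc j) eq = at-ʳ++ xs (x ∷ ys) i j (ℕₚ.suc-injective (trans (sym (ℕₚ.+-suc i (suc j))) eq))

meets-intro : ∀ xs ys i → at xs i ≡ true → at ys i ≡ true → meets xs ys ≡ true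
meets-intro (true ∷ xs) (true ∷ ys) zero    p q = refl
meets-intro (x ∷ xs)    (y ∷ ys)    (suc i) p q =
  trans (cong ((x ∧ y) ∨_) (meets-intro xs ys i p q)) (Boolₚ.∨-zeroʳ (x ∧ y))

meets-elim : ∀ xs ys → meets xs ys ≡ true → ∃[ i ] at xs i ≡ true × at ys i ≡ true
meets-elim (true ∷ xs)  (true ∷ ys)  eq = 0 , refl , refl
meets-elim (true ∷ xs)  (false ∷ ys) eq with i , p , q ← meets-elim xs ys eq = suc i , p , q
meets-elim (false ∷ xs) (true ∷ ys)  eq with i , p , q ← meets-elim xs ys eq = suc i , p , q
meets-elim (false ∷ xs) (false ∷ ys) eq with i , p , q ← meets-elim xs ys eq = suc i , p , q

-- The search stands at shift `suc k`, with `t` the bitmap shifted so far. A known meeting at some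
-- shift `suc e` ahead ensures that it stops before `t` is empty.
gap-spec : ∀ t b k → t ≡ drop (suc k) b → ∀ e → k ≤ e → meets b (drop (suc e) b) ≡ true →
           meets b (drop (suc (gap t b k)) b) ≡ true ×
           (∀ r → k ≤ r → r < gap t b k → meets b (drop (suc r) b) ≡ false)
gap-spec []      b k t≡ e k≤e hit with meets-elim b (drop (suc e) b) hit
... | i , _ , q = ⊥-elim (ℕₚ.<⇒≱ (at-< b (suc e + i) (trans (sym (at-drop (suc e) b i)) q))
        (ℕₚ.≤-trans (ℕₚ.m∸n≡0⇒m≤n (trans (sym (Listₚ.length-drop (suc k) b)) (cong length (sym t≡))))
          (ℕₚ.≤-trans (s≤s k≤e) (ℕₚ.m≤m+n (suc e) i))))
gap-spec (x ∷ t) b k t≡ e k≤e hit with meets b (x ∷ t) in m≡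
... | true  = trans (cong (meets b) (sym t≡)) m≡ , λ r k≤r r<k → ⊥-elim (ℕₚ.<⇒≱ r<k k≤r)
... | false with ℕₚ.m≤n⇒m<n∨m≡n k≤e
...   | inj₂ refl with () ← trans (sym hit) (trans (cong (meets b) (sym t≡)) m≡)
...   | inj₁ k<e with gap-spec t b (suc k) (tail≡ (suc k) b t≡) e k<e hit
  where
  tail≡ : ∀ k b → x ∷ t ≡ drop k b → t ≡ drop (suc k) b
  tail≡ zero    (y ∷ b) refl = refl
  tail≡ (suc k) (y ∷ b) eq   = tail≡ k b eq
...     | found , none = found , none′
  where
  none′ : ∀ r → k ≤ r → r < gap t b (suc k) → meets b (drop (suc r) b) ≡ false
  none′ r k≤r r< with ℕₚ.m≤n⇒m<n∨m≡n k≤r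
  ... | inj₁ k<r  = none r k<r r<
  ... | inj₂ refl = trans (cong (meets b) (sym t≡)) m≡

enum-elim : ∀ bs s k {x} → x ∈ enum bs s k → ∃[ i ] at bs i ≡ true × x ≡ signed s (k + i)
enum-elim (true ∷ bs)  s k (here refl) = 0 , refl , cong (signed s) (sym (ℕₚ.+-identityʳ k))
enum-elim (true ∷ bs)  s k (there x∈) with i , p , eq ← enum-elim bs s (suc k) x∈ =
  suc i , p , trans eq (cong (signed s) (sym (ℕₚ.+-suc k i)))
enum-elim (false ∷ bs) s k x∈         with i , p , eq ← enum-elim bs s (suc k) x∈ =
  suc i , p , trans eq (cong (signed s) (sym (ℕₚ.+-suc k i)))

enum-intro : ∀ bs s k i → at bs i ≡ true → signed s (k + i) ∈ enum bs s k
enum-intro (true ∷ bs)  s k zero    _ = here (cong (signed s) (ℕₚ.+-identityʳ k))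
enum-intro (true ∷ bs)  s k (suc i) p = there (subst (λ n → signed s n ∈ enum bs s (suc k)) (sym (ℕₚ.+-suc k i)) (enum-intro bs s (suc k) i p))
enum-intro (false ∷ bs) s k (suc i) p = subst (λ n → signed s n ∈ enum bs s (suc k)) (sym (ℕₚ.+-suc k i)) (enum-intro bs s (suc k) i p)

-- Positions beyond either end read as unset, so leaving the window counts as not winning.
atℤ : List Bool → ℤ → Bool
atℤ bs (+ i)    = at bs i
atℤ bs -[1+ i ] = false

atℤ-nonneg : ∀ bs {z} → atℤ bs z ≡ true → ∃[ i ] z ≡ + i × at bs i ≡ true
atℤ-nonneg bs {+ i} eq = i , refl , eq

at-pad : ∀ p b z k → + k ≡ z ℤ.+ + p → at (zeros p ++ b) k ≡ atℤ b z
at-pad zero    b z        k       eq = cong (atℤ b) (trans eq (ℤₚ.+-identityʳ z))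
at-pad (suc p) b -[1+ j ] zero    eq = refl
at-pad (suc p) b (+ j)    zero    eq with () ← trans eq (cong +_ (ℕₚ.+-suc j p))
at-pad (suc p) b z        (suc k) eq = at-pad p b z k (begin
  + k                        ≡⟨ e₁ (+ k) ⟩
  + suc k ℤ.+ -[1+ 0 ]       ≡⟨ cong (ℤ._+ -[1+ 0 ]) eq ⟩
  z ℤ.+ + suc p ℤ.+ -[1+ 0 ] ≡⟨ e₂ z (+ p) ⟩
  z ℤ.+ + p                  ∎)
  where
  open ≡-Reasoning
  e₁ : ∀ k → k ≡ (1ℤ ℤ.+ k) ℤ.+ -[1+ 0 ]
  e₁ = ℤSolver.solve-∀
  e₂ : ∀ z p → z ℤ.+ (1ℤ ℤ.+ p) ℤ.+ -[1+ 0 ] ≡ z ℤ.+ p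
  e₂ = ℤSolver.solve-∀

any-intro : ∀ (f : ℕ → Bool) us {u} → u ∈ us → f u ≡ true → any f us ≡ true
any-intro f (_ ∷ us) (here refl) eq = cong (_∨ any f us) eq
any-intro f (u ∷ us) (there u∈)  eq = trans (cong (f u ∨_) (any-intro f us u∈ eq)) (Boolₚ.∨-zeroʳ (f u))

any-elim : ∀ (f : ℕ → Bool) us → any f us ≡ true → ∃[ u ] u ∈ us × f u ≡ true
any-elim f (u ∷ us) eq with f u in fu
... | true  = u , here refl , fu
... | false with v , v∈ , fv ← any-elim f us eq = v , there v∈ , fv

all-intro : ∀ (f : ℕ → Bool) us → (∀ {u} → u ∈ us → f u ≡ true) → all f us ≡ true
all-intro f []       _ = refl
all-intro f (u ∷ us) h = cong₂ _∧_ (h (here refl)) (all-intro f us (h ∘ there))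

all-elim : ∀ (f : ℕ → Bool) us → all f us ≡ true → ∀ {u} → u ∈ us → f u ≡ true
all-elim f (u ∷ us) eq u∈ with f u in fu
all-elim f (u ∷ us) eq (here refl) | true = fu
all-elim f (u ∷ us) eq (there u∈)  | true = all-elim f us eq u∈

scan-intro : ∀ us vs b s i → i < length b → at b i ≡ true ⊎ forces vs us (drop i s) ≡ true →
             at (scan us vs b s) i ≡ true
scan-intro us vs (b ∷ bs) s zero    _         (inj₁ refl) = refl
scan-intro us vs (b ∷ bs) s zero    _         (inj₂ eq)   = trans (cong (b ∨_) eq) (Boolₚ.∨-zeroʳ b)
scan-intro us vs (b ∷ bs) s (suc i) (s≤s i<) h = scan-intro us vs bs (drop 1 s) i i<
  (Sum.map₂ (subst (λ t → forces vs us t ≡ true) (sym (Listₚ.drop-drop 1 i s))) h)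

scan-elim : ∀ us vs b s i → at (scan us vs b s) i ≡ true → at b i ≡ true ⊎ forces vs us (drop i s) ≡ true
scan-elim us vs (true ∷ bs)  s zero    eq = inj₁ refl
scan-elim us vs (false ∷ bs) s zero    eq = inj₂ eq
scan-elim us vs (b ∷ bs)     s (suc i) eq with scan-elim us vs bs (drop 1 s) i eq
... | inj₁ p = inj₁ p
... | inj₂ p = inj₂ (subst (λ t → forces vs us t ≡ true) (Listₚ.drop-drop 1 i s) p)

iterate-suc : ∀ n p us vs b → iterate (suc n) p us vs b ≡ step p us vs (iterate n p us vs b)
iterate-suc zero    p us vs b = refl
iterate-suc (suc n) p us vs b = iterate-suc n p us vs (step p us vs b)

step-mono : ∀ p us vs b i → at b i ≡ true → at (step p us vs b) i ≡ true
step-mono p us vs b i eq = scan-intro us vs b (zeros p ++ b) i (at-< b i eq) (inj₁ eq)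

iterate-mono : ∀ n p us vs b i → at b i ≡ true → at (iterate n p us vs b) i ≡ true
iterate-mono zero    p us vs b i eq = eq
iterate-mono (suc n) p us vs b i eq = iterate-mono n p us vs (step p us vs b) i (step-mono p us vs b i eq)

-- Every non-stationary step sets a new bit.
iterate-fixed : ∀ p us vs b → step p us vs (iterate (length b) p us vs b) ≡ iterate (length b) p us vs b
iterate-fixed p us vs b with stabilises (length b) (λ k i → at (iterate k p us vs b) (toℕ i) ≡ true)
    (λ k i → at (iterate k p us vs b) (toℕ i) Bool.≟ true)
    (λ k _ i eq → trans (cong (λ l → at l (toℕ i)) (iterate-suc k p us vs b)) (step-mono p us vs (iterate k p us vs b) (toℕ i) eq))
... | k , k≤n , stable = subst (λ n → step p us vs (it n) ≡ it n) (ℕₚ.m+[n∸m]≡n k≤n) (fixed (length b ∸ k))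
  where
  it : ℕ → List Bool
  it n = iterate n p us vs b
  true-ext : ∀ {x y} → (x ≡ true → y ≡ true) → (y ≡ true → x ≡ true) → x ≡ y
  true-ext {true}  {y}     f g = sym (f refl)
  true-ext {false} {true}  f g = g refl
  true-ext {false} {false} f g = refl
  fixedₖ : step p us vs (it k) ≡ it k
  fixedₖ = at-≡ _ _ (length-scan us vs (it k) (zeros p ++ it k)) λ i → true-ext
    (λ eq → let i<n = subst (λ n → i < n) (trans (length-scan us vs (it k) (zeros p ++ it k)) (length-iterate k p us vs b)) (at-< (step p us vs (it k)) i eq) in
       subst (λ j → at (it k) j ≡ true) (Finₚ.toℕ-fromℕ< i<n)
         (stable (fromℕ< i<n) (trans (cong₂ at (iterate-suc k p us vs b) (Finₚ.toℕ-fromℕ< i<n)) eq)))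
    (step-mono p us vs (it k) i)
  fixed : ∀ l → step p us vs (it (k + l)) ≡ it (k + l)
  fixed zero    = subst (λ n → step p us vs (it n) ≡ it n) (sym (ℕₚ.+-identityʳ k)) fixedₖ
  fixed (suc l) = subst (λ n → step p us vs (it n) ≡ it n) (sym (ℕₚ.+-suc k l))
    (trans (cong (step p us vs) (trans (iterate-suc (k + l) p us vs b) (fixed l))) (sym (iterate-suc (k + l) p us vs b)))

-- The bitmap computed by the program is a window

offset≡ : ∀ m v → ∣ v ∣ ≤ m → + offset m v ≡ v ℤ.+ + m
offset≡ m (+ n)    _  = refl
offset≡ m -[1+ n ] le = sym (ℤₚ.⊖-≥ le)

∣∣≤⇒≤ : ∀ {m} v → ∣ v ∣ ≤ m → v ℤ.≤ + m
∣∣≤⇒≤ (+ n)    le = +≤+ le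
∣∣≤⇒≤ -[1+ n ] le = -≤+

∣∣≤⇒≥ : ∀ {m} v → ∣ v ∣ ≤ m → ℤ.- + m ℤ.≤ v
∣∣≤⇒≥ {m} v le = subst (ℤ.- + m ℤ.≤_) (ℤₚ.neg-involutive v)
  (ℤₚ.neg-mono-≤ (∣∣≤⇒≤ (ℤ.- v) (subst (_≤ m) (sym (ℤₚ.∣-i∣≡∣i∣ v)) le)))

opaque
  unfolding cube
  -- The left side is `p³ + 2 p² + 4 p`, at most `7 p³` for `p ≥ 1`, against `8 p³` on the right.
  -- The `suc` in `bound` makes `m` positive; `slack` states the difference as a polynomial with
  -- natural coefficients.
  cube-large : ∀ m .{{_ : NonZero m}} → let p = m + m in
               suc p * (suc p * p) + (p + p + p) ≤ cube (p + p)
  cube-large (suc m) = ℕₚ.≤-trans (ℕₚ.m≤m+n _ _) (ℕₚ.≤-reflexive (slack m))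
    where
    slack : ∀ m → suc (suc m + suc m) * (suc (suc m + suc m) * (suc m + suc m)) + (suc m + suc m + (suc m + suc m) + (suc m + suc m))
                  + (56 * m * m * m + 160 * m * m + 144 * m + 40)
                ≡ (suc m + suc m + (suc m + suc m)) * (suc m + suc m + (suc m + suc m)) * (suc m + suc m + (suc m + suc m))
    slack = ℕSolver.solve-∀

module _ (G : RobotGame) where
  open RobotGame G
  open Strategies G
  open Game weight

  private
    B m p : ℕ
    B = halfWindow G
    m = bound G
    p = m + m

  opaque
    -- Opaque, so that type checking does not unfold the iteration.
    winningBits : List Bool
    winningBits = solution G

  S : ℤ → Set
  S x = atℤ winningBits (x ℤ.+ + B) ≡ true

  private
    U≤ : ∀ j → ∣ List.lookup U j ∣ ≤ m
    U≤ j = ℕₚ.≤-trans (≤-sum ∣_∣ U (∈-lookup j)) (ℕₚ.≤-trans (ℕₚ.m≤m+n _ (absSum V)) (ℕₚ.n≤1+n _))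

    V≤ : ∀ i → ∣ List.lookup V i ∣ ≤ m
    V≤ i = ℕₚ.≤-trans (≤-sum ∣_∣ V (∈-lookup i)) (ℕₚ.≤-trans (ℕₚ.m≤n+m _ (absSum U)) (ℕₚ.n≤1+n _))

    oU : Fin (length U) → ℕ
    oU j = offset m (List.lookup U j)

    oV : Fin (length V) → ℕ
    oV i = offset m (List.lookup V i)

    shifted : ∀ b k i j → at (drop (oV i) (drop k (zeros p ++ b))) (oU j) ≡ atℤ b (+ k ℤ.+ weight i j)
    shifted b k i j = trans (at-drop (oV i) (drop k (zeros p ++ b)) (oU j))
      (trans (at-drop k (zeros p ++ b) (oV i + oU j))
        (at-pad p b (+ k ℤ.+ weight i j) (k + (oV i + oU j))
          (trans (cong₂ (λ s t → + k ℤ.+ (s ℤ.+ t)) (offset≡ m (List.lookup V i) (V≤ i)) (offset≡ m (List.lookup U j) (U≤ j)))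
            (regroup (+ k) (List.lookup V i) (List.lookup U j) (+ m)))))
      where
      regroup : ∀ k v u m → k ℤ.+ (v ℤ.+ m ℤ.+ (u ℤ.+ m)) ≡ k ℤ.+ (v ℤ.+ u) ℤ.+ (m ℤ.+ m)
      regroup = ℤSolver.solve-∀

    forces-intro : ∀ b k → (∀ i → ∃[ j ] atℤ b (+ k ℤ.+ weight i j) ≡ true) →
                   forces (offsetsV G) (offsetsU G) (drop k (zeros p ++ b)) ≡ true
    forces-intro b k f = all-intro _ (offsetsV G) λ v∈ → step₁ (∈-map⁻ (offset m) v∈)
      where
      s = drop k (zeros p ++ b)
      step₁ : ∀ {o} → ∃[ v ] v ∈ V × o ≡ offset m v → hits (offsetsU G) (drop o s) ≡ true
      step₁ (v , v∈ , refl) with f (Any.index v∈)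
      ... | j , eq = any-intro (at (drop (offset m v) s)) (offsetsU G) (∈-map⁺ (offset m) (∈-lookup j))
            (subst (λ v → at (drop (offset m v) s) (oU j) ≡ true) (sym (Anyₚ.lookup-index v∈))
              (trans (shifted b k (Any.index v∈) j) eq))

    forces-elim : ∀ b k → forces (offsetsV G) (offsetsU G) (drop k (zeros p ++ b)) ≡ true →
                  ∀ i → ∃[ j ] atℤ b (+ k ℤ.+ weight i j) ≡ true
    forces-elim b k eq i with any-elim _ (offsetsU G)
        (all-elim (λ v → hits (offsetsU G) (drop v (drop k (zeros p ++ b)))) (offsetsV G) eq (∈-map⁺ (offset m) (∈-lookup i)))
    ... | o , o∈ , hit with ∈-map⁻ (offset m) o∈
    ...   | u , u∈ , refl = Any.index u∈ , trans (sym (shifted b k i (Any.index u∈)))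
            (subst (λ u → at (drop (oV i) (drop k (zeros p ++ b))) (offset m u) ≡ true) (Anyₚ.lookup-index u∈) hit)

    Sound : List Bool → Set
    Sound b = ∀ x → atℤ b (x ℤ.+ + B) ≡ true → Win x

    swap : ∀ x w B → x ℤ.+ B ℤ.+ w ≡ x ℤ.+ w ℤ.+ B
    swap = ℤSolver.solve-∀

    step-sound : ∀ {b} → Sound b → Sound (step p (offsetsU G) (offsetsV G) b)
    step-sound {b} sound x eq with atℤ-nonneg (step p (offsetsU G) (offsetsV G) b) {x ℤ.+ + B} eq
    ... | k , x+B≡k , eq′ with scan-elim (offsetsU G) (offsetsV G) b (zeros p ++ b) k eq′
    ...   | inj₁ old = sound x (trans (cong (atℤ b) x+B≡k) old)
    ...   | inj₂ new = move λ i → continue i (forces-elim b k new i)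
      where
      continue : ∀ i → ∃[ j ] atℤ b (+ k ℤ.+ weight i j) ≡ true → ∃[ j ] Win (x ℤ.+ weight i j)
      continue i (j , hit) = j , sound (x ℤ.+ weight i j)
        (trans (cong (atℤ b) (trans (sym (swap x (weight i j) (+ B))) (cong (λ t → t ℤ.+ weight i j) x+B≡k))) hit)

    iterate-sound : ∀ n {b} → Sound b → Sound (iterate n p (offsetsU G) (offsetsV G) b)
    iterate-sound zero    s = s
    iterate-sound (suc n) {b} s = iterate-sound n (step-sound {b} s)

    at-replicate : ∀ n i → at (zeros n) i ≡ false
    at-replicate zero    i       = refl
    at-replicate (suc n) zero    = refl
    at-replicate (suc n) (suc i) = at-replicate n i

    initial-sound : Sound (initial G)
    initial-sound x eq with atℤ-nonneg (initial G) {x ℤ.+ + B} eq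
    ... | k , x+B≡k , eq′ with trans (sym (at-pad B (true ∷ zeros B) x k (sym x+B≡k))) eq′
    ...   | eq″ with atℤ-nonneg (true ∷ zeros B) {x} eq″
    ...     | zero  , refl , _   = won
    ...     | suc i , refl , bad with () ← trans (sym (at-replicate B i)) bad

  opaque
    unfolding winningBits

    length-winningBits : length winningBits ≡ suc (B + B)
    length-winningBits = trans (length-iterate (length (initial G)) p (offsetsU G) (offsetsV G) (initial G)) (length-initial G)

    S-sound : ∀ {x} → S x → Win x
    S-sound {x} = iterate-sound (length (initial G)) initial-sound x

    zero∈S : S 0ℤ
    zero∈S = iterate-mono (length (initial G)) p (offsetsU G) (offsetsV G) (initial G) B
      (at-pad B (true ∷ zeros B) 0ℤ B refl)

    fixed : step p (offsetsU G) (offsetsV G) winningBits ≡ winningBits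
    fixed = iterate-fixed p (offsetsU G) (offsetsV G) (initial G)

  index : ∀ {x} → ℤ.- + B ℤ.≤ x → ∃[ k ] x ℤ.+ + B ≡ + k
  index {x} -B≤x with x ℤ.+ + B | ℤₚ.+-monoˡ-≤ (+ B) -B≤x
  ... | + k      | _  = k , refl
  ... | -[1+ k ] | le with () ← subst (ℤ._≤ -[1+ k ]) (ℤₚ.+-inverseˡ (+ B)) le

  -- One more step would set the bit of `x`, and the bitmap is unchanged by one more step.
  S-closed : ∀ {x} → ℤ.- + B ℤ.≤ x → x ℤ.≤ + B → (∀ i → ∃[ j ] S (x ℤ.+ weight i j)) → S x
  S-closed {x} -B≤x x≤B f with index -B≤x
  ... | k , x+B≡k = trans (cong (atℤ winningBits) x+B≡k) (trans (cong (λ b → at b k) (sym fixed))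
          (scan-intro (offsetsU G) (offsetsV G) winningBits (zeros p ++ winningBits) k
            (subst (k <_) (sym length-winningBits) (s≤s (ℤₚ.drop‿+≤+ (subst (ℤ._≤ + B ℤ.+ + B) x+B≡k (ℤₚ.+-monoˡ-≤ (+ B) x≤B)))))
            (inj₂ (forces-intro winningBits k λ i → proj₁ (f i) , trans
              (cong (atℤ winningBits) (trans (cong (λ t → t ℤ.+ weight i (proj₁ (f i))) (sym x+B≡k)) (swap x (weight i (proj₁ (f i))) (+ B)))) (proj₂ (f i))))))

  S-index : ∀ {x} → S x → ∃[ k ] x ℤ.+ + B ≡ + k × k ≤ B + B × at winningBits k ≡ true
  S-index {x} s with atℤ-nonneg winningBits {x ℤ.+ + B} s
  ... | k , eq , hit = k , eq , ℕₚ.≤-pred (subst (k <_) length-winningBits (at-< winningBits k hit)) , hit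

  window : Window weight p B S
  window = record
    { player  = some V-nonempty
    ; S?      = λ x → atℤ winningBits (x ℤ.+ + B) Bool.≟ true
    ; sound   = λ {x} → S-sound {x}
    ; zero∈S  = zero∈S
    ; closed  = λ {x} → S-closed {x}
    ; S≤      = λ {x} s → upper {x} (S-index {x} s)
    ; ≤S      = λ {x} s → lower {x} (S-index {x} s)
    ; w≤      = λ i j → ℤₚ.+-mono-≤ (∣∣≤⇒≤ (List.lookup V i) (V≤ i)) (∣∣≤⇒≤ (List.lookup U j) (U≤ j))
    ; ≤w      = λ i j → subst (ℤ._≤ weight i j) (sym (ℤₚ.neg-distrib-+ (+ m) (+ m)))
                  (ℤₚ.+-mono-≤ (∣∣≤⇒≥ (List.lookup V i) (V≤ i)) (∣∣≤⇒≥ (List.lookup U j) (U≤ j)))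
    ; B-large = cube-large m
    }
    where
    upper : ∀ {x} → ∃[ k ] x ℤ.+ + B ≡ + k × k ≤ B + B × at winningBits k ≡ true → x ℤ.≤ + B
    upper {x} (k , eq , k≤ , _) = lin (+≤+ k≤) (trans (cong (λ t → + B ℤ.+ t) (sym eq)) (b x (+ B)))
      where
      b : ∀ x B → B ℤ.+ (x ℤ.+ B) ≡ x ℤ.+ (B ℤ.+ B)
      b = ℤSolver.solve-∀
    lower : ∀ {x} → ∃[ k ] x ℤ.+ + B ≡ + k × k ≤ B + B × at winningBits k ≡ true → ℤ.- + B ℤ.≤ x
    lower {x} (k , eq , _) = lin (+≤+ {0} {k} z≤n) (trans (b x (+ B)) (cong (λ t → ℤ.- + B ℤ.+ t) eq))
      where
      b : ∀ x B → x ℤ.+ 0ℤ ≡ ℤ.- B ℤ.+ (x ℤ.+ B)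
      b = ℤSolver.solve-∀

-- Correctness of the description

⟦_⟧? : ∀ D x → Dec (⟦ D ⟧ x)
⟦ only-zero   ⟧? x = x ℤ.≟ 0ℤ
⟦ multiples d ⟧? x = d ℕ∣.∣? ∣ x ∣
⟦ above d b F ⟧? x = (d ℕ∣.∣? ∣ x ∣ Dec.×-dec b ℤ.<? x) Dec.⊎-dec (x ∈? F)
⟦ below d b F ⟧? x = (d ℕ∣.∣? ∣ x ∣ Dec.×-dec x ℤ.<? b) Dec.⊎-dec (x ∈? F)

module _ (G : RobotGame) where
  open Strategies G
  open Game weight

  private
    B d′ : ℕ
    B  = halfWindow G
    d′ = gap (drop 1 (winningBits G)) (winningBits G) 0
    s : List Bool
    s = winningBits G

    meets-S : ∀ r x → S G x → S G (x ℤ.+ + r) → meets s (drop r s) ≡ true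
    meets-S r x a b with S-index G {x} a | S-index G {x ℤ.+ + r} b
    ... | k , eq , _ , hit | k′ , eq′ , _ , hit′ =
      meets-intro s (drop r s) k hit (trans (at-drop r s k) (trans (cong (at s) r+k≡k′) hit′))
      where
      e : ∀ x r B → r ℤ.+ (x ℤ.+ B) ≡ x ℤ.+ r ℤ.+ B
      e = ℤSolver.solve-∀
      r+k≡k′ : r + k ≡ k′
      r+k≡k′ = ℤₚ.+-injective (trans (cong (λ t → + r ℤ.+ t) (sym eq)) (trans (e x (+ r) (+ B)) eq′))

    at⇒S : ∀ k x → x ℤ.+ + B ≡ + k → at s k ≡ true → S G x
    at⇒S k x eq hit = trans (cong (atℤ s) eq) hit

    -- The distance between 0 and `y` occurs in `S`, so the search for the least distance succeeds.
    initial-gap : ∀ {y} → S G y → y ≢ 0ℤ → ∃[ e ] meets s (drop (suc e) s) ≡ true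
    initial-gap {+ zero}   _ y≢0 = ⊥-elim (y≢0 refl)
    initial-gap {+ suc e}  a _   = e , meets-S (suc e) 0ℤ (zero∈S G) a
    initial-gap { -[1+ e ]} a _  = e , meets-S (suc e) -[1+ e ] a
      (subst (S G) (sym (ℤₚ.+-inverseˡ (+ suc e))) (zero∈S G))

    least-gap : ∀ {y} → S G y → y ≢ 0ℤ → LeastGap (S G) (suc d′)
    least-gap {y} a y≢0 with initial-gap {y} a y≢0
    ... | e , hit with gap-spec (drop 1 s) s 0 refl e z≤n hit
    ...   | found , none with meets-elim s (drop (suc d′) s) found
    ...     | k , at₁ , at₂ = record
      { start  = + k ℤ.- + B
      ; first  = at⇒S k (+ k ℤ.- + B) (e₁ (+ k) (+ B)) at₁
      ; second = at⇒S (suc d′ + k) (+ k ℤ.- + B ℤ.+ + suc d′) (e₂ (+ k) (+ B) (+ suc d′)) (trans (sym (at-drop (suc d′) s k)) at₂)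
      ; least  = λ { (suc r) _ (s≤s r<d′) {x} a b →
          case-⊥ (trans (sym (none r z≤n r<d′)) (meets-S (suc r) x a b)) }
      }
      where
      case-⊥ : false ≡ true → ⊥
      case-⊥ ()
      e₁ : ∀ k B → k ℤ.- B ℤ.+ B ≡ k
      e₁ = ℤSolver.solve-∀
      e₂ : ∀ k B d → k ℤ.- B ℤ.+ d ℤ.+ B ≡ d ℤ.+ k
      e₂ = ℤSolver.solve-∀

    right⇒S : ∀ {x} → x ∈ rightOf s B → S G x × 0ℤ ℤ.< x
    right⇒S x∈ with enum-elim (drop (suc B) s) false 0 x∈
    ... | i , hit , refl = at⇒S (suc B + i) (+ suc i) (cong +_ (e i B)) (trans (sym (at-drop (suc B) s i)) hit) , ℤ.+<+ (s≤s z≤n)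
      where
      e : ∀ i B → suc i + B ≡ suc B + i
      e = ℕSolver.solve-∀

    S⇒right : ∀ i → S G (+ suc i) → + suc i ∈ rightOf s B
    S⇒right i a = enum-intro (drop (suc B) s) false 0 i
      (trans (at-drop (suc B) s i) (trans (cong (at s) (e i B)) a))
      where
      e : ∀ i B → suc B + i ≡ suc i + B
      e = ℕSolver.solve-∀

    reversed : ∀ i j → suc (i + j) ≡ B → at (drop (suc B) (s ʳ++ [])) i ≡ at s j
    reversed i j eq = trans (at-drop (suc B) (s ʳ++ []) i) (at-ʳ++ s [] (suc B + i) j
      (trans (e B i j) (trans (cong (λ t → suc (B + t)) eq) (sym (length-winningBits G)))))
      where
      e : ∀ B i j → suc B + i + suc j ≡ suc (B + suc (i + j))
      e = ℕSolver.solve-∀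

    left⇒S : ∀ {x} → x ∈ leftOf s B → S G x × x ℤ.< 0ℤ
    left⇒S x∈ with enum-elim (drop (suc B) (s ʳ++ [])) true 0 x∈
    ... | i , hit , refl = at⇒S j -[1+ i ] (trans (cong (λ t → -[1+ i ] ℤ.+ + t) (sym i+j≡B)) (e (+ i) (+ j)))
            (trans (sym (reversed i j i+j≡B)) hit) , ℤ.-<+
      where
      i<B : i < B
      i<B = ℕₚ.+-cancelˡ-< (suc B) i B (subst (suc B + i <_)
        (trans (Listₚ.length-ʳ++ s) (trans (ℕₚ.+-identityʳ _) (length-winningBits G)))
        (at-< (s ʳ++ []) (suc B + i) (trans (sym (at-drop (suc B) (s ʳ++ []) i)) hit)))
      j : ℕ
      -- The index of the value `-[1+ i ]` in the unreversed bitmap.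
      j = B ∸ suc i
      i+j≡B : suc (i + j) ≡ B
      i+j≡B = ℕₚ.m+[n∸m]≡n i<B
      e : ∀ i j → ℤ.- (1ℤ ℤ.+ i) ℤ.+ (1ℤ ℤ.+ (i ℤ.+ j)) ≡ j
      e = ℤSolver.solve-∀

    S⇒left : ∀ i → S G -[1+ i ] → -[1+ i ] ∈ leftOf s B
    S⇒left i a with S-index G { -[1+ i ]} a
    ... | j , eq , _ , hit = enum-intro (drop (suc B) (s ʳ++ [])) true 0 i (trans (reversed i j (sym (ℤₚ.+-injective B≡))) hit)
      where
      e : ∀ i B → B ≡ (1ℤ ℤ.+ i) ℤ.+ (ℤ.- (1ℤ ℤ.+ i) ℤ.+ B)
      e = ℤSolver.solve-∀
      B≡ : + B ≡ + suc (i + j)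
      B≡ = trans (e (+ i) (+ B)) (cong (λ t → + suc i ℤ.+ t) eq)

    W : Window weight (bound G + bound G) B (S G)
    W = window G

    S⇔ : ∀ (F : List ℤ) {P : Set} → (∀ {x} → S G x → x ∈ 0ℤ ∷ F) → (∀ {x} → x ∈ F → S G x) →
         ∀ x → Win x ⇔ (P ⊎ S G x) → Win x ⇔ (P ⊎ x ∈ 0ℤ ∷ F)
    S⇔ F into from x equiv = mk⇔
      (Sum.map₂ (λ a → into {x} a) ∘ equiv .Equivalence.to)
      (equiv .Equivalence.from ∘ Sum.map₂ λ { (here refl) → zero∈S G ; (there x∈) → from {x} x∈ })

    -- The two lists are arguments and their properties hypotheses, so that matching on them makes
    -- `describe` compute.
    describes : ∀ R L → (∀ {x} → x ∈ R → S G x × 0ℤ ℤ.< x) → (∀ i → S G (+ suc i) → + suc i ∈ R) →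
                (∀ {x} → x ∈ L → S G x × x ℤ.< 0ℤ) → (∀ i → S G -[1+ i ] → -[1+ i ] ∈ L) →
                ∀ x → Win x ⇔ ⟦ describe s B R L ⟧ x
    describes [] [] R⇒ ⇒R L⇒ ⇒L x = mk⇔ (WindowProperties.trivial W λ {x} → zero-only x) λ { refl → won }
      where
      zero-only : ∀ x → S G x → x ≡ 0ℤ
      zero-only (+ zero)  a = refl
      zero-only (+ suc i) a with () ← ⇒R i a
      zero-only -[1+ i ]  a with () ← ⇒L i a
    describes (r ∷ R) [] R⇒ ⇒R L⇒ ⇒L x with R⇒ (here refl)
    ... | r∈S , 0<r = S⇔ (r ∷ R) (λ {x} → into x) (λ x∈ → proj₁ (R⇒ x∈)) x
            (right-sided W (least-gap r∈S r≢0) (λ {x} → nonneg x) r∈S r≢0 x)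
      where
      r≢0 : r ≢ 0ℤ
      r≢0 = ℤₚ.<⇒≢ 0<r ∘ sym
      nonneg : ∀ x → S G x → 0ℤ ℤ.≤ x
      nonneg (+ i)    a = +≤+ z≤n
      nonneg -[1+ i ] a with () ← ⇒L i a
      into : ∀ x → S G x → x ∈ 0ℤ ∷ r ∷ R
      into (+ zero)  a = here refl
      into (+ suc i) a = there (⇒R i a)
      into -[1+ i ]  a with () ← ⇒L i a
    describes [] (l ∷ L) R⇒ ⇒R L⇒ ⇒L x with L⇒ (here refl)
    ... | l∈S , l<0 = S⇔ (l ∷ L) (λ {x} → into x) (λ x∈ → proj₁ (L⇒ x∈)) x
            (left-sided W (least-gap l∈S l≢0) (λ {x} → nonpos x) l∈S l≢0 x)
      where
      l≢0 : l ≢ 0ℤ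
      l≢0 = ℤₚ.<⇒≢ l<0
      nonpos : ∀ x → S G x → x ℤ.≤ 0ℤ
      nonpos (+ zero)  a = +≤+ z≤n
      nonpos (+ suc i) a with () ← ⇒R i a
      nonpos -[1+ i ]  a = -≤+
      into : ∀ x → S G x → x ∈ 0ℤ ∷ l ∷ L
      into (+ zero)  a = here refl
      into (+ suc i) a with () ← ⇒R i a
      into -[1+ i ]  a = there (⇒L i a)
    describes (r ∷ R) (l ∷ L) R⇒ ⇒R L⇒ ⇒L x with R⇒ (here refl) | L⇒ (here refl)
    ... | r∈S , 0<r | l∈S , l<0 = two-sided W (least-gap l∈S (ℤₚ.<⇒≢ l<0)) l∈S l<0 r∈S 0<r x

  opaque
    unfolding winningBits

    answer≡ : answer G ≡ finish s B
    answer≡ = refl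

  Winning⇔answer : ∀ x → Winning G x ⇔ ⟦ answer G ⟧ x
  Winning⇔answer = subst (λ D → ∀ x → Winning G x ⇔ ⟦ D ⟧ x) (sym answer≡)
    (Winning⇔D ⟦ finish s B ⟧? (describes (rightOf s B) (leftOf s B) right⇒S S⇒right left⇒S S⇒left))

-- The time bound in terms of the size

unique-lookup : ∀ {ws : List ℤ} → Unique ws → ∀ i j → List.lookup ws i ≡ List.lookup ws j → i ≡ j
unique-lookup (_ ∷ u)  zero    zero    _  = refl
unique-lookup (w≢ ∷ _) zero    (suc j) eq = ⊥-elim (All.lookup w≢ (∈-lookup j) eq)
unique-lookup (w≢ ∷ _) (suc i) zero    eq = ⊥-elim (All.lookup w≢ (∈-lookup i) (sym eq))
unique-lookup (_ ∷ u)  (suc i) (suc j) eq = cong suc (unique-lookup u i j eq)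

-- `offset K` injects the entries into the numbers up to `2 K`. Distinctness is essential: the size
-- counts every value once, so it does not bound the length of a list with repetitions.
unique-length : ∀ {ws} K → Unique ws → (∀ {w} → w ∈ ws → ∣ w ∣ ≤ K) → length ws ≤ suc (K + K)
unique-length {ws} K unique ≤K = Finₚ.injective⇒≤ {f = f} λ {i} {j} eq →
  unique-lookup unique i j (lookup≡ i j (trans (sym (toℕ-f i)) (trans (cong toℕ eq) (toℕ-f j))))
  where
  f< : ∀ i → offset K (List.lookup ws i) < suc (K + K)
  f< i = s≤s (offset≤ K (List.lookup ws i) (≤K (∈-lookup i)))
  f : Fin (length ws) → Fin (suc (K + K))
  f i = fromℕ< (f< i)
  toℕ-f : ∀ i → toℕ (f i) ≡ offset K (List.lookup ws i)
  toℕ-f i = Finₚ.toℕ-fromℕ< (f< i)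
  cancel : ∀ x K → x ℤ.+ K ℤ.- K ≡ x
  cancel = ℤSolver.solve-∀
  lookup≡ : ∀ i j → offset K (List.lookup ws i) ≡ offset K (List.lookup ws j) → List.lookup ws i ≡ List.lookup ws j
  lookup≡ i j eq = trans (sym (cancel (List.lookup ws i) (+ K)))
    (trans (cong (ℤ._- + K) (trans (sym (offset≡ K (List.lookup ws i) (≤K (∈-lookup i))))
      (trans (cong +_ eq) (offset≡ K (List.lookup ws j) (≤K (∈-lookup j)))))) (cancel (List.lookup ws j) (+ K)))

absSum≤ : ∀ ws K → (∀ {w} → w ∈ ws → ∣ w ∣ ≤ K) → absSum ws ≤ length ws * K
absSum≤ []       K ≤K = z≤n
absSum≤ (w ∷ ws) K ≤K = ℕₚ.+-mono-≤ (≤K (here refl)) (absSum≤ ws K (≤K ∘ there))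

-- Strong induction by halving: `⌈ n /2⌉` is at least half of `n`, and its logarithm is smaller by
-- one.
n≤2^⌈log₂n⌉ : ∀ n → n ≤ 2 ^ ⌈log₂ n ⌉
n≤2^⌈log₂n⌉ = <-rec (λ n → n ≤ 2 ^ ⌈log₂ n ⌉) λ where
    zero            _  → z≤n
    (suc zero)      _  → s≤s z≤n
    (suc (suc n-2)) ih → halve (suc (suc n-2)) (s≤s (s≤s z≤n)) (ih (ℕₚ.⌈n/2⌉<n n-2))
  where
  halve : ∀ n → 2 ≤ n → ⌈ n /2⌉ ≤ 2 ^ ⌈log₂ ⌈ n /2⌉ ⌉ → n ≤ 2 ^ ⌈log₂ n ⌉
  halve n 2≤n ih with ⌈log₂ n ⌉ | ⌈log₂⌉-mono-≤ 2≤n | ⌈log₂⌈n/2⌉⌉≡⌈log₂n⌉∸1 n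
  ... | suc k | _ | eq = begin
    n                 ≡⟨ ℕₚ.⌊n/2⌋+⌈n/2⌉≡n n ⟨
    ⌊ n /2⌋ + ⌈ n /2⌉ ≤⟨ ℕₚ.+-monoˡ-≤ ⌈ n /2⌉ (ℕₚ.⌊n/2⌋≤⌈n/2⌉ n) ⟩
    ⌈ n /2⌉ + ⌈ n /2⌉ ≤⟨ ℕₚ.+-mono-≤ half (ℕₚ.≤-trans half (ℕₚ.≤-reflexive (sym (ℕₚ.+-identityʳ _)))) ⟩
    2 ^ suc k         ∎
    where
    open ℕₚ.≤-Reasoning
    half : ⌈ n /2⌉ ≤ 2 ^ k
    half = subst (λ l → ⌈ n /2⌉ ≤ 2 ^ l) eq ih

module _ (G : RobotGame) where
  open RobotGame G

  private
    n K : ℕ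
    n = size G
    K = 2 ^ n

    ≤K : ∀ {w} → w ∈ U ++ V → ∣ w ∣ ≤ K
    ≤K {w} w∈ = ℕₚ.≤-trans (n≤2^⌈log₂n⌉ ∣ w ∣) (ℕₚ.^-monoʳ-≤ 2
      (≤-sum (λ w → ⌈log₂ ∣ w ∣ ⌉) (List.deduplicate ℤ._≟_ (U ++ V)) (∈-deduplicate⁺ ℤ._≟_ w∈)))

    #U : length U ≤ suc (K + K)
    #U = unique-length K U-unique (≤K ∘ ∈-++⁺ˡ)

    #V : length V ≤ suc (K + K)
    #V = unique-length K V-unique (≤K ∘ ∈-++⁺ʳ U)

    1≤K : 1 ≤ K
    1≤K = ℕₚ.m^n>0 2 n

    -- The window is [-B , B] with B = (4 bound)³, 4 bound ≤ 2 ^ a, and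
    -- N = 2 ^ e bounds the lengths of all bitmaps.
    a e : ℕ
    a = 5 + (n + n)
    e = 17 * suc n

    bound≤ : bound G ≤ 8 * (K * K)
    bound≤ = begin
      suc (absSum U + absSum V)
        ≤⟨ s≤s (ℕₚ.+-mono-≤ (ℕₚ.≤-trans (absSum≤ U K (≤K ∘ ∈-++⁺ˡ)) (ℕₚ.*-monoˡ-≤ K #U))
                            (ℕₚ.≤-trans (absSum≤ V K (≤K ∘ ∈-++⁺ʳ U)) (ℕₚ.*-monoˡ-≤ K #V))) ⟩
      suc (suc (K + K) * K + suc (K + K) * K)   ≡⟨ e₁ K ⟩
      1 + 2 * K + 4 * (K * K)                   ≤⟨ ℕₚ.+-monoˡ-≤ (4 * (K * K)) (ℕₚ.+-mono-≤ 1≤KK (ℕₚ.*-monoʳ-≤ 2 K≤KK)) ⟩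
      -- Seven times `K * K` is rounded up to eight times, to have a power of two as factor.
      K * K + 2 * (K * K) + 4 * (K * K)         ≤⟨ ℕₚ.m≤m+n _ (K * K) ⟩
      K * K + 2 * (K * K) + 4 * (K * K) + K * K ≡⟨ e₂ (K * K) ⟩
      8 * (K * K)                               ∎
      where
      open ℕₚ.≤-Reasoning
      K≤KK : K ≤ K * K
      K≤KK = ℕₚ.m≤m*n K K {{ℕ.>-nonZero 1≤K}}
      1≤KK : 1 ≤ K * K
      1≤KK = ℕₚ.≤-trans 1≤K K≤KK
      e₁ : ∀ K → suc (suc (K + K) * K + suc (K + K) * K) ≡ 1 + 2 * K + 4 * (K * K)
      e₁ = ℕSolver.solve-∀
      e₂ : ∀ L → L + 2 * L + 4 * L + L ≡ 8 * L
      e₂ = ℕSolver.solve-∀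

    quadruple≤ : (bound G + bound G) + (bound G + bound G) ≤ 2 ^ a
    quadruple≤ = begin
      (m + m) + (m + m)           ≡⟨ e₁ m ⟩
      4 * m                       ≤⟨ ℕₚ.*-monoʳ-≤ 4 bound≤ ⟩
      4 * (8 * (K * K))           ≡⟨ ℕₚ.*-assoc 4 8 (K * K) ⟨
      2 ^ 5 * (K * K)             ≡⟨ cong (2 ^ 5 *_) (ℕₚ.^-distribˡ-+-* 2 n n) ⟨
      2 ^ 5 * 2 ^ (n + n)         ≡⟨ ℕₚ.^-distribˡ-+-* 2 5 (n + n) ⟨
      2 ^ a                       ∎
      where
      open ℕₚ.≤-Reasoning
      m = bound G
      e₁ : ∀ m → (m + m) + (m + m) ≡ 4 * m
      e₁ = ℕSolver.solve-∀

    opaque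
      unfolding cube
      cube-mono : ∀ {q r} → q ≤ r → cube q ≤ r * r * r
      cube-mono le = ℕₚ.*-mono-≤ (ℕₚ.*-mono-≤ le le) le

    half≤ : halfWindow G ≤ 2 ^ (a + a + a)
    half≤ = ℕₚ.≤-trans (cube-mono quadruple≤) (ℕₚ.≤-reflexive (sym
      (trans (ℕₚ.^-distribˡ-+-* 2 (a + a) a) (cong (_* 2 ^ a) (ℕₚ.^-distribˡ-+-* 2 a a)))))

    double : ∀ {x y} f → x ≤ 2 ^ f → y ≤ 2 ^ f → x + y ≤ 2 ^ suc f
    double f x≤ y≤ = ℕₚ.+-mono-≤ x≤ (ℕₚ.≤-trans y≤ (ℕₚ.≤-reflexive (sym (ℕₚ.+-identityʳ _))))

    -- The 2 comes from doubling twice in `window≤`. The sum `2 + (a + a + a)` is `17 + 6 n`, and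
    -- `11 * n` fills it up to a multiple of `suc n`.
    exponent : 2 + (a + a + a) + 11 * n ≡ e
    exponent = lemma n
      where
      lemma : ∀ n → 2 + (5 + (n + n) + (5 + (n + n)) + (5 + (n + n))) + 11 * n ≡ 17 * suc n
      lemma = ℕSolver.solve-∀

    opaque
      N : ℕ
      N = 2 ^ e

      ^≤N : ∀ k → k ≤ 2 + (a + a + a) + 11 * n → 2 ^ k ≤ N
      ^≤N k k≤ = ℕₚ.^-monoʳ-≤ 2 (ℕₚ.≤-trans k≤ (ℕₚ.≤-reflexive exponent))

      N^11 : N ^ 11 ≡ 2 ^ (11 * 17 * suc n)
      N^11 = trans (ℕₚ.^-*-assoc 2 e 11) (cong (2 ^_) (trans (ℕₚ.*-comm e 11) (sym (ℕₚ.*-assoc 11 17 (suc n)))))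

    window≤ : 4 + (halfWindow G + halfWindow G) ≤ N
    window≤ = ℕₚ.≤-trans
      (double (suc (a + a + a)) (ℕₚ.^-monoʳ-≤ 2 {2} {suc (a + a + a)} (s≤s (s≤s z≤n))) (double (a + a + a) half≤ half≤))
      (^≤N (2 + (a + a + a)) (ℕₚ.m≤m+n _ (11 * n)))

    big : maxNodes ≤ N
    big = ℕₚ.≤-trans (toWitness {a? = maxNodes ℕ.≤? 2 ^ 9} _) (^≤N 9
      (ℕₚ.≤-trans (ℕₚ.≤-trans (toWitness {a? = 9 ℕ.≤? 17} _) (ℕₚ.m≤m+n 17 (6 * n)))
        (ℕₚ.≤-trans (ℕₚ.≤-reflexive (lemma n)) (ℕₚ.m≤m+n (2 + (a + a + a)) (11 * n)))))
      where
      lemma : ∀ n → 17 + 6 * n ≡ 2 + (5 + (n + n) + (5 + (n + n)) + (5 + (n + n)))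
      lemma = ℕSolver.solve-∀

    length< : ∀ {l} → l ≤ suc (K + K) → l < N
    length< l≤ = ℕₚ.≤-trans (s≤s l≤) (ℕₚ.≤-trans
      (double (suc n) (ℕₚ.^-monoʳ-≤ 2 {1} {suc n} (s≤s z≤n)) (double n ℕₚ.≤-refl ℕₚ.≤-refl))
      (^≤N (suc (suc n)) (s≤s (s≤s (ℕₚ.≤-trans (ℕₚ.m≤n*m n 11) (ℕₚ.m≤n+m (11 * n) (a + a + a)))))))

  answer-time : ∃[ t ] OnInput_Returns_InTime_ program (encodeGame G) (encodeDescription (answer G)) t
                       × t ≤ 2 ^ (11 * 17 * suc (size G))
  answer-time = map₂ (map₂ λ t≤ → ℕₚ.≤-trans t≤ (ℕₚ.≤-reflexive N^11))
    (main-time G N big window≤ (length< #U) (length< #V))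

theorem14 : Σ[ P ∈ Program ] ∃[ c ] ∀ (G : RobotGame) →
    Σ[ D ∈ Description ] ∃[ t ]
    (OnInput_Returns_InTime_ P (encodeGame G) (encodeDescription D) t
    × t ≤ 2 ^ (c * suc (size G))
    × (∀ x → Winning G x ⇔ ⟦ D ⟧ x))
theorem14 = program , 11 * 17 , λ G →
  let t , run , t≤ = answer-time G in answer G , t , run , t≤ , Winning⇔answer G
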